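{- Let $p>3$ be a prime. Then $$\sum_{k=0}^{p-1}\frac{\binom{2k}{k}}{2^k}H_k^{(2)}\equiv -E_{p-3}\pmod p.$$
   Context: For $n=0,1,2,\ldots$, $H_n^{(2)}:=\sum_{0<k\leqslant n}\frac{1}{k^2}$ (so $H_0^{(2)}=0$). The Euler numbers $E_0,E_1,E_2,\ldots$ are the integers given by $E_0=1$ and the recursion $\sum_{0\leqslant k\leqslant n,\ 2\mid k}\binom{n}{k}E_{n-k}=0$ for $n=1,2,3,\ldots$. Congruences modulo a power $p^a$ between rational numbers are understood in the ring of rational numbers whose denominators are not divisible by $p$. -}

module Defs where

import Algebra.Properties.CommutativeMonoid.Sum as Sum
open import Data.Bool.Base using (if_then_else_)
open import Data.Fin.Base using (Fin; zero; suc; toℕ)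
open import Data.Integer.Base as ℤ using (ℤ; +_; 0ℤ; 1ℤ)
import Data.Integer.Properties as ℤ
open import Data.Nat.Base using (ℕ; zero; suc; _∸_; _^_)
open import Data.Nat.Combinatorics using (_C_)
open import Data.Nat.Divisibility using (_∣_; _∣?_)
open import Data.Product.Base using (∃-syntax; _×_)
open import Data.Rational.Base as ℚ using (ℚ; ↧ₙ_; _/_)
import Data.Rational.Properties as ℚ
open import Data.Vec.Base using (Vec; []; _∷_; head; lookup)
open import Relation.Binary.PropositionalEquality
open import Relation.Nullary.Decidable.Core using (does)
open import Relation.Nullary.Negation.Core using (¬_)

-- ∑[ i < n ] t sums t over i : Fin n, so toℕ i runs through 0, …, n - 1.
module ∑ℤ = Sum ℤ.+-0-commutativeMonoid
module ∑ℚ = Sum ℚ.+-0-commutativeMonoid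

-- The summation index is shifted: k = toℕ i + 1 runs through 1, …, n.
H⁽²⁾ : ℕ → ℚ
H⁽²⁾ n = ∑[ i < n ] (1ℤ / (suc (toℕ i) ^ 2))
  where open ∑ℚ using (sum-syntax)

evenOnly : ℕ → ℤ → ℤ
evenOnly k z = if does (2 ∣? k) then z else 0ℤ

-- eulers n = E n ∷ E (n - 1) ∷ … ∷ E 0 ∷ [].  The term k = 0 of the defining
-- recursion ∑_{0 ≤ k ≤ n, 2 ∣ k} (n C k) E (n - k) = 0 is E n, so E n is minus
-- the sum of the terms with k ≥ 1 (here k = toℕ i + 1, with n + 1 for n).
eulers : (n : ℕ) → Vec ℤ (suc n)
eulers zero    = 1ℤ ∷ []
eulers (suc n) = ℤ.- (∑[ i < suc n ] term i) ∷ eulers n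
  where
  open ∑ℤ using (sum-syntax)
  term : Fin (suc n) → ℤ
  term i = evenOnly k (+ (suc n C k) ℤ.* lookup (eulers n) i)
    where k = suc (toℕ i)

E : ℕ → ℤ
E n = head (eulers n)

lookup-eulers : ∀ n (i : Fin (suc n)) → lookup (eulers n) i ≡ E (n ∸ toℕ i)
lookup-eulers zero    zero    = refl
lookup-eulers (suc n) zero    = refl
lookup-eulers (suc n) (suc i) = lookup-eulers n i

E-zero : E 0 ≡ 1ℤ
E-zero = refl

E-recursion : ∀ n → let open ∑ℤ using (sum-syntax); N = suc n in
  ∑[ k < suc N ] evenOnly (toℕ k) (+ (N C toℕ k) ℤ.* E (N ∸ toℕ k)) ≡ 0ℤ
E-recursion n = begin
  1ℤ ℤ.* E (suc n) ℤ.+ ∑[ i < suc n ] rest i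
    ≡⟨ cong₂ ℤ._+_ (ℤ.*-identityˡ (E (suc n))) (∑ℤ.sum-cong-≗ rest≗) ⟩
  E (suc n) ℤ.+ ∑[ i < suc n ] rest′ i
    ≡⟨ ℤ.+-inverseˡ (∑[ i < suc n ] rest′ i) ⟩
  0ℤ ∎
  where
  open ≡-Reasoning
  open ∑ℤ using (sum-syntax)
  rest rest′ : Fin (suc n) → ℤ
  rest  i = evenOnly (suc (toℕ i)) (+ (suc n C suc (toℕ i)) ℤ.* E (n ∸ toℕ i))
  rest′ i = evenOnly (suc (toℕ i)) (+ (suc n C suc (toℕ i)) ℤ.* lookup (eulers n) i)
  rest≗ : ∀ i → rest i ≡ rest′ i
  rest≗ i = cong (λ e → evenOnly (suc (toℕ i)) (+ (suc n C suc (toℕ i)) ℤ.* e))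
                 (sym (lookup-eulers n i))

-- Membership in ℤ₍ₚ₎; ↧ₙ q is the denominator of q in lowest terms.
_-Integral_ : ℕ → ℚ → Set
p -Integral q = ¬ (p ∣ ↧ₙ q)

-- Congruence in the ring ℤ₍ₚ₎ modulo its ideal generated by p.
infix 4 _≡_[mod_]
_≡_[mod_] : ℚ → ℚ → ℕ → Set
x ≡ y [mod p ] =
  p -Integral x × p -Integral y ×
  ∃[ z ] (p -Integral z × x ℚ.- y ≡ (+ p / 1) ℚ.* z)

module Submission where

open import Defs

-- Let p = 2n + 1.  Modulo p we have C(2k,k) / 2^k ≡ (-2)^k C(n,k) and
-- 1/a² ≡ ν a = a^(p-3), so the sum is T = ∑_j (-2)^j C(n,j) h_j with
-- h_j = ∑_{0<i≤j} ν i.  A first-order recursion shows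
--   C(n,n-k) h_(n-k) ≡ -8 · 4^k ∑_{m<n} C(m+k,2k) ν (2m+1).
-- Since ∑_k C(m+k,2k) (-2)^k is the sign χ m = √2 cos ((2m+1)π/4), this gives
-- T ≡ -8 (-2)^n ∑_{m<n} χ m · ν (2m+1).  The case m = n of the same sum yields
-- (-2)^n ≡ (-1)^n χ n, and the reflection r ↦ p - r turns T into
-- -2 ∑_{m<n} (-1)^m ν (2m+1).  Finally, the sums Q_i = 2 ∑_{m<n} (-1)^m (2m+1)^i
-- satisfy the recursion of the Euler numbers at even i up to a boundary term
-- that only affects Q_0, because (2m+2)^i + (2m)^i telescopes against (-1)^m;
-- hence Q_(p-3) ≡ E_(p-3).

-- The binomials C(m+k,2k) are chosen because 4^k (2k)! C(m+k,2k) is the product of (2m+1)² -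
-- (2j+1)² over j < k. Raising k therefore multiplies by a difference of two squares: the first
-- cancels the inverse square ν (2m+1), and the second is a constant in m. This is what makes the
-- recursion first order. The main obstacle is division. All of the argument except its last step
-- takes place in ℤ: powers and an integer half replace inverses, and any other denominator is
-- cleared by multiplying both sides by a positive factor below p and cancelling it afterwards.
-- Hence the many bounds on indices. Rational numbers enter only when each summand is matched with
-- an integer residue.

module Proof where

  open import Data.Fin.Base using (Fin; zero; suc; toℕ; opposite)
  open import Data.Fin.Permutation using (reverse)
  open import Data.Fin.Properties using (opposite-prop; toℕ<n)
  open import Data.Integer.Base hiding (suc; _/_; _<_; _≤_)
  import Data.Integer.Divisibility.Signed as Signed
  import Data.Integer.Properties as ℤ
  open import Data.Integer.Tactic.RingSolver using (solve-∀)
  open import Data.Nat.Base as ℕ using (ℕ; zero; suc; _∸_; _<_; _≤_; s≤s; s<s; z<s)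
  open import Data.Nat.Combinatorics using (_C_; nCk≡nC[n∸k]; nCn≡1; nCk+nC[k+1]≡[n+1]C[k+1]; k>n⇒nCk≡0)
  import Data.Nat.Coprimality as Coprimality
  import Data.Nat.Divisibility as ℕ
  open import Data.Nat.Induction using (<-rec)
  open import Data.Nat.Primality using (Prime; euclidsLemma; prime⇒irreducible; prime⇒nonTrivial)
  import Data.Nat.Properties as ℕ
  import Data.Nat.Tactic.RingSolver as ℕ-Solver
  open import Data.Product.Base using (_×_; _,_; proj₁; proj₂; ∃-syntax)
  open import Data.Rational.Base as ℚ using (ℚ; mkℚ; 0ℚ; _/_; toℚᵘ)
  import Data.Rational.Properties as ℚ
  open import Data.Rational.Unnormalised.Base as ℚᵘ using (ℚᵘ; mkℚᵘ; *≡*)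
  import Data.Rational.Unnormalised.Properties as ℚᵘ
  open import Data.Sum.Base using (_⊎_; inj₁; inj₂)
  open import Function.Base using (_∘_; case_of_)
  open import Relation.Binary.Bundles using (Setoid)
  open import Relation.Binary.PropositionalEquality using (_≡_; refl; sym; trans; cong; cong₂; subst; module ≡-Reasoning)
  import Relation.Binary.Reasoning.Setoid
  open import Relation.Nullary.Negation.Core using (¬_; contradiction)

  module Integers where

    open ≡-Reasoning

    -- Finite sums of integers.

    opaque
      -- The summand lives on ℕ rather than on `Fin n`, so that it can be shifted by composition and
      -- shared by sums of different lengths. Opaqueness keeps sums as written instead of letting
      -- them unfold.
      Σ< : ℕ → (ℕ → ℤ) → ℤ
      Σ< n f = ∑ℤ.sum {n} (f ∘ toℕ)

      Σ<-∑ : ∀ n f → Σ< n f ≡ ∑ℤ.sum {n} (f ∘ toℕ)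
      Σ<-∑ n f = refl

      Σ<-empty : ∀ f → Σ< 0 f ≡ 0ℤ
      Σ<-empty f = refl

      Σ<-first : ∀ n f → Σ< (suc n) f ≡ f 0 + Σ< n (f ∘ suc)
      Σ<-first n f = refl

      Σ<-cong : ∀ n {f g} → (∀ i → f i ≡ g i) → Σ< n f ≡ Σ< n g
      Σ<-cong n f≗g = ∑ℤ.sum-cong-≗ {n} (f≗g ∘ toℕ)

      Σ<-last : ∀ n f → Σ< (suc n) f ≡ Σ< n f + f n
      Σ<-last zero    f = ℤ.+-comm (f 0) 0ℤ
      Σ<-last (suc n) f = begin
        f 0 + Σ< (suc n) (f ∘ suc)          ≡⟨ cong (_+_ (f 0)) (Σ<-last n (f ∘ suc)) ⟩
        f 0 + (Σ< n (f ∘ suc) + f (suc n))  ≡⟨ ℤ.+-assoc (f 0) _ _ ⟨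
        Σ< (suc n) f + f (suc n)            ∎

      Σ<-distrib-+ : ∀ n f g → Σ< n (λ i → f i + g i) ≡ Σ< n f + Σ< n g
      Σ<-distrib-+ n f g = ∑ℤ.∑-distrib-+ {n} (f ∘ toℕ) (g ∘ toℕ)

      *-distribˡ-Σ< : ∀ n x f → Σ< n (λ i → x * f i) ≡ x * Σ< n f
      *-distribˡ-Σ< zero    x f = sym (ℤ.*-zeroʳ x)
      *-distribˡ-Σ< (suc n) x f = begin
        x * f 0 + Σ< n (λ i → x * f (suc i))  ≡⟨ cong (_+_ (x * f 0)) (*-distribˡ-Σ< n x (f ∘ suc)) ⟩
        x * f 0 + x * Σ< n (f ∘ suc)          ≡⟨ ℤ.*-distribˡ-+ x (f 0) _ ⟨
        x * Σ< (suc n) f                      ∎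

      Σ<-comm : ∀ m n (f : ℕ → ℕ → ℤ) → Σ< m (λ i → Σ< n (f i)) ≡ Σ< n (λ j → Σ< m (λ i → f i j))
      Σ<-comm m n f = ∑ℤ.∑-comm {m} {n} (λ i j → f (toℕ i) (toℕ j))

      Σ<-+ : ∀ m n f → Σ< (m ℕ.+ n) f ≡ Σ< m f + Σ< n (f ∘ (m ℕ.+_))
      Σ<-+ zero    n f = sym (ℤ.+-identityˡ (Σ< n f))
      Σ<-+ (suc m) n f = trans (cong (_+_ (f 0)) (Σ<-+ m n (f ∘ suc))) (sym (ℤ.+-assoc (f 0) _ _))

      Σ<-zero : ∀ n f → (∀ i → f i ≡ 0ℤ) → Σ< n f ≡ 0ℤ
      Σ<-zero zero    f f≡0 = refl
      Σ<-zero (suc n) f f≡0 = cong₂ _+_ (f≡0 0) (Σ<-zero n (f ∘ suc) (f≡0 ∘ suc))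

    Σ<-pairs : ∀ n f → Σ< (n ℕ.+ n) f ≡ Σ< n (λ m → f (m ℕ.+ m)) + Σ< n (λ m → f (suc (m ℕ.+ m)))
    Σ<-pairs zero    f = begin
      Σ< 0 f                  ≡⟨ Σ<-empty f ⟩
      0ℤ + 0ℤ                 ≡⟨ cong₂ _+_ (Σ<-empty _) (Σ<-empty _) ⟨
      Σ< 0 _ + Σ< 0 _         ∎
    Σ<-pairs (suc n) f = begin
      Σ< (suc n ℕ.+ suc n) f
        ≡⟨ cong (λ k → Σ< (suc k) f) (ℕ.+-suc n n) ⟩
      Σ< (suc (suc (n ℕ.+ n))) f
        ≡⟨ Σ<-last (suc (n ℕ.+ n)) f ⟩
      Σ< (suc (n ℕ.+ n)) f + b
        ≡⟨ cong (_+ b) (Σ<-last (n ℕ.+ n) f) ⟩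
      Σ< (n ℕ.+ n) f + a + b
        ≡⟨ cong (λ s → s + a + b) (Σ<-pairs n f) ⟩
      Σ< n even + Σ< n odd + a + b
        ≡⟨ shuffle (Σ< n even) (Σ< n odd) a b ⟩
      (Σ< n even + a) + (Σ< n odd + b)
        ≡⟨ cong₂ _+_ (Σ<-last n even) (Σ<-last n odd) ⟨
      Σ< (suc n) even + Σ< (suc n) odd ∎
      where
      even odd : ℕ → ℤ
      even m = f (m ℕ.+ m)
      odd  m = f (suc (m ℕ.+ m))
      a = f (n ℕ.+ n)
      b = f (suc (n ℕ.+ n))
      shuffle : ∀ x y a b → x + y + a + b ≡ (x + a) + (y + b)
      shuffle = solve-∀

    -- Binomial coefficients as integers.

    infix 8 _Cℤ_
    opaque
      _Cℤ_ : ℕ → ℕ → ℤ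
      n Cℤ k = + (n C k)

      Cℤ-C : ∀ n k → n Cℤ k ≡ + (n C k)
      Cℤ-C n k = refl

      Cℤ-0 : ∀ n → n Cℤ 0 ≡ 1ℤ
      Cℤ-0 n = refl

      pascal : ∀ n k → suc n Cℤ suc k ≡ n Cℤ k + n Cℤ suc k
      pascal n k = cong +_ (sym (nCk+nC[k+1]≡[n+1]C[k+1] n k))

      Cℤ-zero : ∀ {n k} → n < k → n Cℤ k ≡ 0ℤ
      Cℤ-zero n<k = cong +_ (k>n⇒nCk≡0 n<k)

      Cℤ-self : ∀ n → n Cℤ n ≡ 1ℤ
      Cℤ-self n = cong +_ (nCn≡1 n)

      Cℤ-sym : ∀ i j → (i ℕ.+ j) Cℤ i ≡ (i ℕ.+ j) Cℤ j
      Cℤ-sym i j = cong +_ (trans (nCk≡nC[n∸k] (ℕ.m≤m+n i j)) (cong ((i ℕ.+ j) C_) (ℕ.m+n∸m≡n i j)))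

    -- The difference n - k is taken in ℤ, so the identity also covers k > n, where both binomials
    -- vanish.
    Cℤ-absorb : ∀ n k → (1ℤ + + k) * n Cℤ suc k ≡ (+ n + - + k) * n Cℤ k
    Cℤ-absorb zero zero = begin
      1ℤ * 0 Cℤ 1         ≡⟨ cong (1ℤ *_) (Cℤ-zero {0} {1} z<s) ⟩
      0ℤ                  ∎
    Cℤ-absorb zero (suc k) = begin
      + suc (suc k) * 0 Cℤ suc (suc k)          ≡⟨ cong (+ suc (suc k) *_) (Cℤ-zero {k = suc (suc k)} z<s) ⟩
      + suc (suc k) * 0ℤ                        ≡⟨ ℤ.*-zeroʳ (+ suc (suc k)) ⟩
      0ℤ                                        ≡⟨ ℤ.*-zeroʳ (0ℤ + - + suc k) ⟨
      (0ℤ + - + suc k) * 0ℤ                     ≡⟨ cong ((0ℤ + - + suc k) *_) (Cℤ-zero {k = suc k} z<s) ⟨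
      (0ℤ + - + suc k) * 0 Cℤ suc k             ∎
    Cℤ-absorb (suc n) zero = begin
      1ℤ * suc n Cℤ 1             ≡⟨ cong (1ℤ *_) (pascal n 0) ⟩
      1ℤ * (n Cℤ 0 + n Cℤ 1)      ≡⟨ ℤ.*-distribˡ-+ 1ℤ (n Cℤ 0) (n Cℤ 1) ⟩
      1ℤ * n Cℤ 0 + 1ℤ * n Cℤ 1   ≡⟨ cong (_+_ (1ℤ * n Cℤ 0)) (Cℤ-absorb n 0) ⟩
      1ℤ * n Cℤ 0 + (+ n + 0ℤ) * n Cℤ 0
        ≡⟨ alg (+ n) (n Cℤ 0) ⟩
      (1ℤ + + n + 0ℤ) * n Cℤ 0
        ≡⟨ cong ((1ℤ + + n + 0ℤ) *_) (trans (Cℤ-0 n) (sym (Cℤ-0 (suc n)))) ⟩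
      (1ℤ + + n + 0ℤ) * suc n Cℤ 0 ∎
      where
      alg : ∀ x y → 1ℤ * y + (x + 0ℤ) * y ≡ (1ℤ + x + 0ℤ) * y
      alg = solve-∀
    Cℤ-absorb (suc n) (suc k) = begin
      (1ℤ + (1ℤ + K)) * suc n Cℤ suc (suc k)  ≡⟨ cong ((1ℤ + (1ℤ + K)) *_) (pascal n (suc k)) ⟩
      (1ℤ + (1ℤ + K)) * (b + c)               ≡⟨ ℤ.*-distribˡ-+ (1ℤ + (1ℤ + K)) b c ⟩
      (1ℤ + (1ℤ + K)) * b + (1ℤ + (1ℤ + K)) * c
        ≡⟨ cong (_+_ ((1ℤ + (1ℤ + K)) * b)) (Cℤ-absorb n (suc k)) ⟩
      (1ℤ + (1ℤ + K)) * b + (N + - (1ℤ + K)) * b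
        ≡⟨ alg₁ N K b ⟩
      (1ℤ + K) * b + (N + - K) * b
        ≡⟨ cong (_+ (N + - K) * b) (Cℤ-absorb n k) ⟩
      (N + - K) * a + (N + - K) * b
        ≡⟨ alg₂ N K a b ⟩
      (1ℤ + N + - (1ℤ + K)) * (a + b)
        ≡⟨ cong ((1ℤ + N + - (1ℤ + K)) *_) (pascal n k) ⟨
      (1ℤ + N + - (1ℤ + K)) * suc n Cℤ suc k ∎
      where
      N = + n
      K = + k
      a = n Cℤ k
      b = n Cℤ suc k
      c = n Cℤ suc (suc k)
      alg₁ : ∀ N K b → (1ℤ + (1ℤ + K)) * b + (N + - (1ℤ + K)) * b ≡ (1ℤ + K) * b + (N + - K) * b
      alg₁ = solve-∀
      alg₂ : ∀ N K a b → (N + - K) * a + (N + - K) * b ≡ (1ℤ + N + - (1ℤ + K)) * (a + b)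
      alg₂ = solve-∀

    Cℤ-absorb-suc : ∀ n k → (1ℤ + + k) * suc n Cℤ suc k ≡ (1ℤ + + n) * n Cℤ k
    Cℤ-absorb-suc n k = begin
      (1ℤ + K) * suc n Cℤ suc k                ≡⟨ cong ((1ℤ + K) *_) (pascal n k) ⟩
      (1ℤ + K) * (a + n Cℤ suc k)              ≡⟨ ℤ.*-distribˡ-+ (1ℤ + K) a _ ⟩
      (1ℤ + K) * a + (1ℤ + K) * n Cℤ suc k     ≡⟨ cong (_+_ ((1ℤ + K) * a)) (Cℤ-absorb n k) ⟩
      (1ℤ + K) * a + (+ n + - K) * a           ≡⟨ alg (+ n) K a ⟩
      (1ℤ + + n) * a                           ∎
      where
      K = + k
      a = n Cℤ k
      alg : ∀ N K a → (1ℤ + K) * a + (N + - K) * a ≡ (1ℤ + N) * a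
      alg = solve-∀

    C[m+k,2k+1]-step : ∀ m k → (1ℤ + (+ k + + k)) * (m ℕ.+ k) Cℤ suc (k ℕ.+ k) ≡ (+ m + - + k) * (m ℕ.+ k) Cℤ (k ℕ.+ k)
    C[m+k,2k+1]-step m k = trans (Cℤ-absorb (m ℕ.+ k) (k ℕ.+ k)) (cong (_* (m ℕ.+ k) Cℤ (k ℕ.+ k)) (alg (+ m) (+ k)))
      where
      alg : ∀ M K → M + K + - (K + K) ≡ M + - K
      alg = solve-∀

    -- Absorption is applied twice: from 2k to 2k + 1 with the top fixed, and from 2k + 1 to 2k + 2
    -- with the top raised.
    C[m+k,2k]-step : ∀ m k → (1ℤ + (+ k + + k)) * (+ 2 + (+ k + + k)) * (m ℕ.+ suc k) Cℤ (suc k ℕ.+ suc k)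
                           ≡ (+ m + + k + 1ℤ) * (+ m + - + k) * (m ℕ.+ k) Cℤ (k ℕ.+ k)
    C[m+k,2k]-step m k = begin
      c * d * (m ℕ.+ suc k) Cℤ (suc k ℕ.+ suc k)
        ≡⟨ cong₂ (λ x y → c * d * x Cℤ suc y) (ℕ.+-suc m k) (ℕ.+-suc k k) ⟩
      c * d * suc (m ℕ.+ k) Cℤ suc (suc (k ℕ.+ k))
        ≡⟨ ℤ.*-assoc c d _ ⟩
      c * (d * suc (m ℕ.+ k) Cℤ suc (suc (k ℕ.+ k)))
        ≡⟨ cong (c *_) (Cℤ-absorb-suc (m ℕ.+ k) (suc (k ℕ.+ k))) ⟩
      c * ((1ℤ + (M + K)) * (m ℕ.+ k) Cℤ suc (k ℕ.+ k))
        ≡⟨ alg₁ c M K _ ⟩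
      (M + K + 1ℤ) * (c * (m ℕ.+ k) Cℤ suc (k ℕ.+ k))
        ≡⟨ cong ((M + K + 1ℤ) *_) (C[m+k,2k+1]-step m k) ⟩
      (M + K + 1ℤ) * ((M + - K) * (m ℕ.+ k) Cℤ (k ℕ.+ k))
        ≡⟨ ℤ.*-assoc (M + K + 1ℤ) (M + - K) _ ⟨
      (M + K + 1ℤ) * (M + - K) * (m ℕ.+ k) Cℤ (k ℕ.+ k) ∎
      where
      M = + m
      K = + k
      c = 1ℤ + (K + K)
      d = + 2 + (K + K)
      alg₁ : ∀ c M K x → c * ((1ℤ + (M + K)) * x) ≡ (M + K + 1ℤ) * (c * x)
      alg₁ = solve-∀

    -- By symmetry, Pascal's rule splits the central binomial into two equal parts, hence the factor
    -- 2.
    C[2k,k]-step : ∀ k → (1ℤ + + k) * (suc k ℕ.+ suc k) Cℤ suc k ≡ + 2 * ((1ℤ + (+ k + + k)) * (k ℕ.+ k) Cℤ k)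
    C[2k,k]-step k = begin
      (1ℤ + + k) * (suc k ℕ.+ suc k) Cℤ suc k
        ≡⟨ cong ((1ℤ + + k) *_) (pascal (k ℕ.+ suc k) k) ⟩
      (1ℤ + + k) * ((k ℕ.+ suc k) Cℤ k + (k ℕ.+ suc k) Cℤ suc k)
        ≡⟨ cong (λ x → (1ℤ + + k) * (x + (k ℕ.+ suc k) Cℤ suc k)) (Cℤ-sym k (suc k)) ⟩
      (1ℤ + + k) * ((k ℕ.+ suc k) Cℤ suc k + (k ℕ.+ suc k) Cℤ suc k)
        ≡⟨ alg (1ℤ + + k) _ ⟩
      + 2 * ((1ℤ + + k) * (k ℕ.+ suc k) Cℤ suc k)
        ≡⟨ cong (λ n → + 2 * ((1ℤ + + k) * n Cℤ suc k)) (ℕ.+-suc k k) ⟩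
      + 2 * ((1ℤ + + k) * suc (k ℕ.+ k) Cℤ suc k)
        ≡⟨ cong (+ 2 *_) (Cℤ-absorb-suc (k ℕ.+ k) k) ⟩
      + 2 * ((1ℤ + (+ k + + k)) * (k ℕ.+ k) Cℤ k) ∎
      where
      alg : ∀ a x → a * (x + x) ≡ + 2 * (a * x)
      alg = solve-∀

    hockey-stick : ∀ n k → Σ< n (λ m → (m ℕ.+ k) Cℤ (k ℕ.+ k)) ≡ (n ℕ.+ k) Cℤ suc (k ℕ.+ k)
    hockey-stick zero    k = trans (Σ<-empty _) (sym (Cℤ-zero (s≤s (ℕ.m≤m+n k k))))
    hockey-stick (suc n) k = begin
      Σ< (suc n) (λ m → (m ℕ.+ k) Cℤ (k ℕ.+ k))
        ≡⟨ Σ<-last n (λ m → (m ℕ.+ k) Cℤ (k ℕ.+ k)) ⟩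
      Σ< n (λ m → (m ℕ.+ k) Cℤ (k ℕ.+ k)) + (n ℕ.+ k) Cℤ (k ℕ.+ k)
        ≡⟨ cong (_+ (n ℕ.+ k) Cℤ (k ℕ.+ k)) (hockey-stick n k) ⟩
      (n ℕ.+ k) Cℤ suc (k ℕ.+ k) + (n ℕ.+ k) Cℤ (k ℕ.+ k)
        ≡⟨ ℤ.+-comm ((n ℕ.+ k) Cℤ suc (k ℕ.+ k)) _ ⟩
      (n ℕ.+ k) Cℤ (k ℕ.+ k) + (n ℕ.+ k) Cℤ suc (k ℕ.+ k)
        ≡⟨ pascal (n ℕ.+ k) (k ℕ.+ k) ⟨
      (suc n ℕ.+ k) Cℤ suc (k ℕ.+ k) ∎

    binomial-theorem : ∀ n x → (1ℤ + x) ^ n ≡ Σ< (suc n) (λ k → n Cℤ k * x ^ k)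
    binomial-theorem zero    x = begin
      1ℤ * 1ℤ               ≡⟨ cong (_* 1ℤ) (Cℤ-0 0) ⟨
      0 Cℤ 0 * 1ℤ           ≡⟨ ℤ.+-identityˡ _ ⟨
      0ℤ + 0 Cℤ 0 * 1ℤ      ≡⟨ cong (_+ 0 Cℤ 0 * 1ℤ) (Σ<-empty term) ⟨
      Σ< 0 term + term 0    ≡⟨ Σ<-last 0 term ⟨
      Σ< 1 term             ∎
      where
      term : ℕ → ℤ
      term k = 0 Cℤ k * x ^ k
    binomial-theorem (suc n) x = begin
      (1ℤ + x) * (1ℤ + x) ^ n
        ≡⟨ ℤ.*-distribʳ-+ ((1ℤ + x) ^ n) 1ℤ x ⟩
      1ℤ * (1ℤ + x) ^ n + x * (1ℤ + x) ^ n
        ≡⟨ cong₂ (λ a b → 1ℤ * a + x * b) (trans (binomial-theorem n x) extend) (binomial-theorem n x) ⟩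
      1ℤ * (n Cℤ 0 * 1ℤ + Σ< (suc n) (term n ∘ suc)) + x * Σ< (suc n) (term n)
        ≡⟨ cong (_+_ (1ℤ * (n Cℤ 0 * 1ℤ + Σ< (suc n) (term n ∘ suc)))) (*-distribˡ-Σ< (suc n) x (term n)) ⟨
      1ℤ * (n Cℤ 0 * 1ℤ + Σ< (suc n) (term n ∘ suc)) + Σ< (suc n) (λ k → x * term n k)
        ≡⟨ alg (n Cℤ 0 * 1ℤ) _ _ ⟩
      n Cℤ 0 * 1ℤ + (Σ< (suc n) (term n ∘ suc) + Σ< (suc n) (λ k → x * term n k))
        ≡⟨ cong (_+_ (n Cℤ 0 * 1ℤ)) (Σ<-distrib-+ (suc n) _ _) ⟨
      n Cℤ 0 * 1ℤ + Σ< (suc n) (λ k → term n (suc k) + x * term n k)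
        ≡⟨ cong₂ (λ a b → a * 1ℤ + b) (trans (Cℤ-0 n) (sym (Cℤ-0 (suc n)))) (Σ<-cong (suc n) λ k →
             trans (combine (n Cℤ k) (n Cℤ suc k) x (x ^ k)) (cong (_* x ^ suc k) (sym (pascal n k)))) ⟩
      suc n Cℤ 0 * 1ℤ + Σ< (suc n) (term (suc n) ∘ suc)
        ≡⟨ Σ<-first (suc n) (term (suc n)) ⟨
      Σ< (suc (suc n)) (term (suc n)) ∎
      where
      term : ℕ → ℕ → ℤ
      term n k = n Cℤ k * x ^ k
      -- The vanishing term k = n + 1 is appended so that the sum, split at its front, aligns with
      -- its copy multiplied by x.
      extend : Σ< (suc n) (term n) ≡ n Cℤ 0 * 1ℤ + Σ< (suc n) (term n ∘ suc)
      extend = begin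
        Σ< (suc n) (term n)
          ≡⟨ ℤ.+-identityʳ _ ⟨
        Σ< (suc n) (term n) + 0ℤ
          ≡⟨ cong (λ z → Σ< (suc n) (term n) + z * x ^ suc n) (Cℤ-zero (ℕ.n<1+n n)) ⟨
        Σ< (suc n) (term n) + term n (suc n)
          ≡⟨ Σ<-last (suc n) (term n) ⟨
        Σ< (suc (suc n)) (term n)
          ≡⟨ Σ<-first (suc n) (term n) ⟩
        n Cℤ 0 * 1ℤ + Σ< (suc n) (term n ∘ suc) ∎
      alg : ∀ z a b → 1ℤ * (z + a) + b ≡ z + (a + b)
      alg = solve-∀
      combine : ∀ a b x y → b * (x * y) + x * (a * y) ≡ (a + b) * (x * y)
      combine = solve-∀

    *-^ : ∀ x y k → (x * y) ^ k ≡ x ^ k * y ^ k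
    *-^ x y zero    = refl
    *-^ x y (suc k) = trans (cong (x * y *_) (*-^ x y k)) (alg x y (x ^ k) (y ^ k))
      where
      alg : ∀ x y a b → x * y * (a * b) ≡ x * a * (y * b)
      alg = solve-∀

    pos-^ : ∀ a k → + (a ℕ.^ k) ≡ (+ a) ^ k
    pos-^ a zero    = refl
    pos-^ a (suc k) = trans (ℤ.pos-* a (a ℕ.^ k)) (cong (+ a *_) (pos-^ a k))

    neg-^-even : ∀ x k → (- x) ^ (k ℕ.+ k) ≡ x ^ (k ℕ.+ k)
    neg-^-even x k = begin
      (- x) ^ (k ℕ.+ k)        ≡⟨ ℤ.^-distribˡ-+-* (- x) k k ⟩
      (- x) ^ k * (- x) ^ k    ≡⟨ *-^ (- x) (- x) k ⟨
      (- x * - x) ^ k          ≡⟨ cong (_^ k) (alg x) ⟩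
      (x * x) ^ k              ≡⟨ *-^ x x k ⟩
      x ^ k * x ^ k            ≡⟨ ℤ.^-distribˡ-+-* x k k ⟨
      x ^ (k ℕ.+ k)            ∎
      where
      alg : ∀ x → - x * - x ≡ x * x
      alg = solve-∀

    -- Trigonometric signs as binomial sums.

    -- χ m = √2 cos ((2m + 1)π/4) and β m = sin (mπ/2).
    χ β : ℕ → ℤ
    χ 0             = 1ℤ
    χ 1             = -1ℤ
    χ (suc (suc m)) = - χ m
    β 0             = 0ℤ
    β 1             = 1ℤ
    β (suc (suc m)) = - β m

    -- Together with `χ-suc`, this is the coupled recursion that Pascal's rule yields for the two
    -- sums of `χ-as-sum`.
    β-suc : ∀ m → β (suc m) ≡ χ m + β m
    β-suc 0             = refl
    β-suc 1             = refl
    β-suc (suc (suc m)) = trans (cong -_ (β-suc m)) (ℤ.neg-distrib-+ (χ m) (β m))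

    χ-suc : ∀ m → χ (suc m) ≡ χ m + - + 2 * β (suc m)
    χ-suc 0             = refl
    χ-suc 1             = refl
    χ-suc (suc (suc m)) = trans (cong -_ (χ-suc m)) (alg (χ m) (β (suc m)))
      where
      alg : ∀ x y → - (x + - + 2 * y) ≡ - x + - + 2 * - y
      alg = solve-∀

    χ² : ∀ m → χ m * χ m ≡ 1ℤ
    χ² 0             = refl
    χ² 1             = refl
    χ² (suc (suc m)) = trans (alg (χ m)) (χ² m)
      where
      alg : ∀ x → - x * - x ≡ x * x
      alg = solve-∀

    χ-adjacent : ∀ m → -1ℤ ^ suc m * χ (suc m) * χ m ≡ 1ℤ
    χ-adjacent zero    = refl
    χ-adjacent (suc m) = trans (alg (-1ℤ ^ suc m) (χ m) (χ (suc m))) (χ-adjacent m)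
      where
      alg : ∀ s x y → -1ℤ * s * - x * y ≡ s * y * x
      alg = solve-∀

    -- With y = 2 cos θ - 2 in place of -2, the sums are the Chebyshev polynomials cos ((m + 1/2)θ)
    -- / cos (θ/2) and sin (mθ) / sin θ; y = -2 means θ = π/2. Each family feeds the other, so one
    -- induction on m proves both. The common cutoff `K` omits only zero terms, and it lets sums for
    -- different m be interchanged later.
    χ-as-sum : ∀ K m → m ≤ K →
      Σ< (suc K) (λ k → (m ℕ.+ k) Cℤ (k ℕ.+ k) * (- + 2) ^ k) ≡ χ m ×
      Σ< (suc K) (λ k → (m ℕ.+ k) Cℤ suc (k ℕ.+ k) * (- + 2) ^ k) ≡ β m
    χ-as-sum K zero _ =
        (begin
          Σ< (suc K) even              ≡⟨ Σ<-first K even ⟩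
          even 0 + Σ< K (even ∘ suc)   ≡⟨ cong₂ (λ a b → a * 1ℤ + b) (Cℤ-0 0) (Σ<-zero K (even ∘ suc) λ k →
                                            cong (_* y ^ suc k) (Cℤ-zero (ℕ.m<m+n (suc k) z<s))) ⟩
          1ℤ                           ∎)
      , Σ<-zero (suc K) odd (λ k → cong (_* y ^ k) (Cℤ-zero (s≤s (ℕ.m≤m+n k k))))
      where
      y : ℤ
      y = - + 2
      even odd : ℕ → ℤ
      even k = k Cℤ (k ℕ.+ k) * y ^ k
      odd  k = k Cℤ suc (k ℕ.+ k) * y ^ k
    χ-as-sum K (suc m) m<K = even-sum , odd-sum
      where
      y : ℤ
      y = - + 2
      even odd : ℕ → ℕ → ℤ
      even m k = (m ℕ.+ k) Cℤ (k ℕ.+ k) * y ^ k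
      odd  m k = (m ℕ.+ k) Cℤ suc (k ℕ.+ k) * y ^ k

      ih : Σ< (suc K) (even m) ≡ χ m × Σ< (suc K) (odd m) ≡ β m
      ih = χ-as-sum K m (ℕ.<⇒≤ m<K)

      odd-sum : Σ< (suc K) (odd (suc m)) ≡ β (suc m)
      odd-sum = begin
        Σ< (suc K) (odd (suc m))
          ≡⟨ Σ<-cong (suc K) (λ k → trans (cong (_* y ^ k) (pascal (m ℕ.+ k) (k ℕ.+ k)))
               (ℤ.*-distribʳ-+ (y ^ k) ((m ℕ.+ k) Cℤ (k ℕ.+ k)) _)) ⟩
        Σ< (suc K) (λ k → even m k + odd m k)
          ≡⟨ Σ<-distrib-+ (suc K) (even m) (odd m) ⟩
        Σ< (suc K) (even m) + Σ< (suc K) (odd m)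
          ≡⟨ cong₂ _+_ (proj₁ ih) (proj₂ ih) ⟩
        χ m + β m
          ≡⟨ β-suc m ⟨
        β (suc m) ∎

      even-step : ∀ k → even (suc m) (suc k) ≡ even m (suc k) + y * odd (suc m) k
      even-step k = begin
        suc (m ℕ.+ suc k) Cℤ suc (k ℕ.+ suc k) * y ^ suc k
          ≡⟨ cong (_* y ^ suc k) (pascal (m ℕ.+ suc k) (k ℕ.+ suc k)) ⟩
        ((m ℕ.+ suc k) Cℤ (k ℕ.+ suc k) + (m ℕ.+ suc k) Cℤ suc (k ℕ.+ suc k)) * y ^ suc k
          ≡⟨ cong₂ (λ a b → (a Cℤ b + (m ℕ.+ suc k) Cℤ suc (k ℕ.+ suc k)) * y ^ suc k) (ℕ.+-suc m k) (ℕ.+-suc k k) ⟩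
        ((suc m ℕ.+ k) Cℤ suc (k ℕ.+ k) + (m ℕ.+ suc k) Cℤ suc (k ℕ.+ suc k)) * (y * y ^ k)
          ≡⟨ alg ((suc m ℕ.+ k) Cℤ suc (k ℕ.+ k)) _ y (y ^ k) ⟩
        even m (suc k) + y * odd (suc m) k ∎
        where
        alg : ∀ a b y z → (a + b) * (y * z) ≡ b * (y * z) + y * (a * z)
        alg = solve-∀

      -- Shifting k leaves only K terms. The missing one contains C(m+1+K, 2K+1), which is zero
      -- because m < K.
      drop-last : Σ< K (odd (suc m)) ≡ Σ< (suc K) (odd (suc m))
      drop-last = sym (begin
        Σ< (suc K) (odd (suc m))
          ≡⟨ Σ<-last K (odd (suc m)) ⟩
        Σ< K (odd (suc m)) + odd (suc m) K
          ≡⟨ cong (λ z → Σ< K (odd (suc m)) + z * y ^ K) (Cℤ-zero (s≤s (ℕ.+-monoˡ-≤ K m<K))) ⟩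
        Σ< K (odd (suc m)) + 0ℤ
          ≡⟨ ℤ.+-identityʳ _ ⟩
        Σ< K (odd (suc m)) ∎)

      even-sum : Σ< (suc K) (even (suc m)) ≡ χ (suc m)
      even-sum = begin
        Σ< (suc K) (even (suc m))
          ≡⟨ Σ<-first K (even (suc m)) ⟩
        even (suc m) 0 + Σ< K (even (suc m) ∘ suc)
          ≡⟨ cong₂ (λ a b → a * 1ℤ + b) (trans (Cℤ-0 _) (sym (Cℤ-0 (m ℕ.+ 0)))) (Σ<-cong K even-step) ⟩
        even m 0 + Σ< K (λ k → even m (suc k) + y * odd (suc m) k)
          ≡⟨ cong (_+_ (even m 0)) (Σ<-distrib-+ K (even m ∘ suc) _) ⟩
        even m 0 + (Σ< K (even m ∘ suc) + Σ< K (λ k → y * odd (suc m) k))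
          ≡⟨ ℤ.+-assoc (even m 0) _ _ ⟨
        even m 0 + Σ< K (even m ∘ suc) + Σ< K (λ k → y * odd (suc m) k)
          ≡⟨ cong₂ _+_ (sym (Σ<-first K (even m))) (*-distribˡ-Σ< K y (odd (suc m))) ⟩
        Σ< (suc K) (even m) + y * Σ< K (odd (suc m))
          ≡⟨ cong₂ (λ a b → a + y * b) (proj₁ ih) (trans drop-last odd-sum) ⟩
        χ m + y * β (suc m)
          ≡⟨ χ-suc m ⟨
        χ (suc m) ∎

    -- Signs with a reflection symmetry.

    -1^-square : ∀ k → -1ℤ ^ k * -1ℤ ^ k ≡ 1ℤ
    -1^-square k = trans (sym (*-^ -1ℤ -1ℤ k)) (ℤ.^-zeroˡ k)

    -- For c = (-1)^n this is r ↦ (-1)^n χ n χ (n - r) where r ≤ n (see ω-χ), extended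
    -- beyond n so as to be symmetric under r ↦ 2n + 1 - r.
    ω : ℤ → ℕ → ℤ
    ω c 0             = c
    ω c 1             = 1ℤ
    ω c (suc (suc r)) = - ω c r

    ω-odd : ∀ c m → ω c (suc (m ℕ.+ m)) ≡ -1ℤ ^ m
    ω-odd c zero    = refl
    ω-odd c (suc m) = begin
      - ω c (m ℕ.+ suc m)       ≡⟨ cong (λ k → - ω c k) (ℕ.+-suc m m) ⟩
      - ω c (suc (m ℕ.+ m))     ≡⟨ cong -_ (ω-odd c m) ⟩
      - -1ℤ ^ m                 ≡⟨ ℤ.-1*i≡-i (-1ℤ ^ m) ⟨
      -1ℤ ^ suc m               ∎

    ω-even : ∀ c m → ω c (m ℕ.+ m) ≡ -1ℤ ^ m * c
    ω-even c zero    = sym (ℤ.*-identityˡ c)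
    ω-even c (suc m) = begin
      ω c (suc (m ℕ.+ suc m))   ≡⟨ cong (λ k → ω c (suc k)) (ℕ.+-suc m m) ⟩
      - ω c (m ℕ.+ m)           ≡⟨ cong -_ (ω-even c m) ⟩
      - (-1ℤ ^ m * c)           ≡⟨ alg (-1ℤ ^ m) c ⟩
      -1ℤ ^ suc m * c           ∎
      where
      alg : ∀ x c → - (x * c) ≡ -1ℤ * x * c
      alg = solve-∀

    -- Moving 2 from b to a negates both sides, which leaves b = 0 and b = 1. These two cases are
    -- what dictates the value (-1)^n at 0.
    ω-reflect : ∀ n a b → a ℕ.+ b ≡ suc (n ℕ.+ n) → ω (-1ℤ ^ n) a ≡ ω (-1ℤ ^ n) b
    ω-reflect n a 0             eq = begin
      ω (-1ℤ ^ n) a                 ≡⟨ cong (ω (-1ℤ ^ n)) (trans (sym (ℕ.+-identityʳ a)) eq) ⟩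
      ω (-1ℤ ^ n) (suc (n ℕ.+ n))   ≡⟨ ω-odd (-1ℤ ^ n) n ⟩
      -1ℤ ^ n                       ∎
    ω-reflect n a 1             eq = begin
      ω (-1ℤ ^ n) a                 ≡⟨ cong (ω (-1ℤ ^ n)) (ℕ.suc-injective (trans (ℕ.+-comm 1 a) eq)) ⟩
      ω (-1ℤ ^ n) (n ℕ.+ n)         ≡⟨ ω-even (-1ℤ ^ n) n ⟩
      -1ℤ ^ n * -1ℤ ^ n             ≡⟨ -1^-square n ⟩
      1ℤ                            ∎
    ω-reflect n a (suc (suc b)) eq = begin
      ω (-1ℤ ^ n) a                 ≡⟨ ℤ.neg-involutive _ ⟨
      - - ω (-1ℤ ^ n) a             ≡⟨ cong -_ (ω-reflect n (suc (suc a)) b (trans (sym (trans (ℕ.+-suc a (suc b)) (cong suc (ℕ.+-suc a b)))) eq)) ⟩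
      - ω (-1ℤ ^ n) b               ∎

    -- Both sides change sign when 2 is moved from r to i, so `χ²` and `χ-adjacent` settle
    -- everything.
    ω-χ : ∀ n i r → i ℕ.+ r ≡ n → -1ℤ ^ n * χ n * χ i ≡ ω (-1ℤ ^ n) r
    ω-χ n i 0             eq = begin
      -1ℤ ^ n * χ n * χ i           ≡⟨ cong (λ i → -1ℤ ^ n * χ n * χ i) (trans (sym (ℕ.+-identityʳ i)) eq) ⟩
      -1ℤ ^ n * χ n * χ n           ≡⟨ ℤ.*-assoc (-1ℤ ^ n) (χ n) (χ n) ⟩
      -1ℤ ^ n * (χ n * χ n)         ≡⟨ cong (-1ℤ ^ n *_) (χ² n) ⟩
      -1ℤ ^ n * 1ℤ                  ≡⟨ ℤ.*-identityʳ (-1ℤ ^ n) ⟩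
      -1ℤ ^ n                       ∎
    ω-χ n i 1             eq = begin
      -1ℤ ^ n * χ n * χ i           ≡⟨ cong (λ n → -1ℤ ^ n * χ n * χ i) (trans (sym eq) (ℕ.+-comm i 1)) ⟩
      -1ℤ ^ suc i * χ (suc i) * χ i ≡⟨ χ-adjacent i ⟩
      1ℤ                            ∎
    ω-χ n i (suc (suc r)) eq = begin
      -1ℤ ^ n * χ n * χ i           ≡⟨ alg (-1ℤ ^ n * χ n) (χ i) ⟩
      - (-1ℤ ^ n * χ n * - χ i)     ≡⟨ cong -_ (ω-χ n (suc (suc i)) r (trans (sym (trans (ℕ.+-suc i (suc r)) (cong suc (ℕ.+-suc i r)))) eq)) ⟩
      - ω (-1ℤ ^ n) r               ∎
      where
      alg : ∀ a b → a * b ≡ - (a * - b)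
      alg = solve-∀

    telescope : ∀ n (f : ℕ → ℤ) → Σ< n (λ m → -1ℤ ^ m * (f (suc m) + f m)) ≡ f 0 + - (-1ℤ ^ n * f n)
    telescope zero    f = trans (Σ<-empty _) (alg (f 0))
      where
      alg : ∀ x → 0ℤ ≡ x + - (1ℤ * x)
      alg = solve-∀
    telescope (suc n) f = begin
      Σ< (suc n) term                                               ≡⟨ Σ<-last n term ⟩
      Σ< n term + term n                                            ≡⟨ cong (_+ term n) (telescope n f) ⟩
      f 0 + - (-1ℤ ^ n * f n) + -1ℤ ^ n * (f (suc n) + f n)         ≡⟨ alg (f 0) (f n) (f (suc n)) (-1ℤ ^ n) ⟩
      f 0 + - (-1ℤ ^ suc n * f (suc n))                             ∎
      where
      term : ℕ → ℤ
      term m = -1ℤ ^ m * (f (suc m) + f m)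
      alg : ∀ a b c s → a + - (s * b) + s * (c + b) ≡ a + - (-1ℤ * s * c)
      alg = solve-∀

    -- Binomial sums over even indices and the Euler recursion.

    -- The indicator of the even numbers: it turns the conditional in `evenOnly` into a factor that
    -- ring identities can move.
    ε : ℕ → ℤ
    ε k = evenOnly k 1ℤ

    evenOnly-ε : ∀ k z → evenOnly k z ≡ ε k * z
    evenOnly-ε 0             z = sym (ℤ.*-identityˡ z)
    evenOnly-ε 1             z = refl
    evenOnly-ε (suc (suc k)) z = evenOnly-ε k z

    ε-even : ∀ k → ε (k ℕ.+ k) ≡ 1ℤ
    ε-even zero    = refl
    ε-even (suc k) = trans (cong (λ j → ε (suc j)) (ℕ.+-suc k k)) (ε-even k)

    ε-odd : ∀ k → ε (suc (k ℕ.+ k)) ≡ 0ℤ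
    ε-odd zero    = refl
    ε-odd (suc k) = trans (cong (λ j → ε (suc (suc j))) (ℕ.+-suc k k)) (ε-odd k)

    ε-reflect : ∀ M i j → i ℕ.+ j ≡ M ℕ.+ M → ε i ≡ ε j
    ε-reflect M i 0 eq = trans (cong ε (trans (sym (ℕ.+-identityʳ i)) eq)) (ε-even M)
    ε-reflect (suc M) i 1 eq =
      trans (cong ε (trans (ℕ.suc-injective (trans (ℕ.+-comm 1 i) eq)) (ℕ.+-suc M M))) (ε-odd M)
    ε-reflect zero i 1 eq = case trans (ℕ.+-comm 1 i) eq of λ ()
    ε-reflect M i (suc (suc j)) eq =
      ε-reflect M (suc (suc i)) j (trans (sym (trans (ℕ.+-suc i (suc j)) (cong suc (ℕ.+-suc i j)))) eq)

    x^k+[-x]^k : ∀ x k → x ^ k + (- x) ^ k ≡ + 2 * (ε k * x ^ k)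
    x^k+[-x]^k x 0 = refl
    x^k+[-x]^k x 1 = alg x
      where
      alg : ∀ x → x * 1ℤ + - x * 1ℤ ≡ + 2 * (0ℤ * (x * 1ℤ))
      alg = solve-∀
    x^k+[-x]^k x (suc (suc k)) = begin
      x * (x * x ^ k) + - x * (- x * (- x) ^ k)   ≡⟨ alg₁ x (x ^ k) ((- x) ^ k) ⟩
      x * x * (x ^ k + (- x) ^ k)                 ≡⟨ cong (x * x *_) (x^k+[-x]^k x k) ⟩
      x * x * (+ 2 * (ε k * x ^ k))               ≡⟨ alg₂ x (x ^ k) (ε k) ⟩
      + 2 * (ε k * (x * (x * x ^ k)))             ∎
      where
      alg₁ : ∀ x y z → x * (x * y) + - x * (- x * z) ≡ x * x * (y + z)
      alg₁ = solve-∀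
      alg₂ : ∀ x y e → x * x * (+ 2 * (e * y)) ≡ + 2 * (e * (x * (x * y)))
      alg₂ = solve-∀

    -- Adding the expansions at x and -x doubles the even powers and cancels the odd ones.
    even-binomial-sum : ∀ N x → + 2 * Σ< (suc N) (λ i → ε i * (N Cℤ i * x ^ i)) ≡ (1ℤ + x) ^ N + (1ℤ + - x) ^ N
    even-binomial-sum N x = begin
      + 2 * Σ< (suc N) (λ i → ε i * (N Cℤ i * x ^ i))
        ≡⟨ *-distribˡ-Σ< (suc N) (+ 2) _ ⟨
      Σ< (suc N) (λ i → + 2 * (ε i * (N Cℤ i * x ^ i)))
        ≡⟨ Σ<-cong (suc N) termwise ⟩
      Σ< (suc N) (λ i → N Cℤ i * x ^ i + N Cℤ i * (- x) ^ i)
        ≡⟨ Σ<-distrib-+ (suc N) _ _ ⟩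
      Σ< (suc N) (λ i → N Cℤ i * x ^ i) + Σ< (suc N) (λ i → N Cℤ i * (- x) ^ i)
        ≡⟨ cong₂ _+_ (binomial-theorem N x) (binomial-theorem N (- x)) ⟨
      (1ℤ + x) ^ N + (1ℤ + - x) ^ N ∎
      where
      alg : ∀ e c y → + 2 * (e * (c * y)) ≡ c * (+ 2 * (e * y))
      alg = solve-∀
      termwise : ∀ i → + 2 * (ε i * (N Cℤ i * x ^ i)) ≡ N Cℤ i * x ^ i + N Cℤ i * (- x) ^ i
      termwise i = begin
        + 2 * (ε i * (N Cℤ i * x ^ i))          ≡⟨ alg (ε i) (N Cℤ i) (x ^ i) ⟩
        N Cℤ i * (+ 2 * (ε i * x ^ i))          ≡⟨ cong (N Cℤ i *_) (x^k+[-x]^k x i) ⟨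
        N Cℤ i * (x ^ i + (- x) ^ i)            ≡⟨ ℤ.*-distribˡ-+ (N Cℤ i) (x ^ i) _ ⟩
        N Cℤ i * x ^ i + N Cℤ i * (- x) ^ i     ∎

    -- The left side of the Euler recursion with top index 2M, reindexed by i ↦ 2M - i. As the top
    -- is even, only values of `f` at even arguments enter.
    evenSum : ℕ → (ℕ → ℤ) → ℤ
    evenSum M f = Σ< (suc (M ℕ.+ M)) (λ i → ε i * ((M ℕ.+ M) Cℤ i * f i))

    evenSum-linear : ∀ M (f g h : ℕ → ℤ) →
      evenSum M (λ i → f i + - (g i + h i)) ≡ evenSum M f + - (evenSum M g + evenSum M h)
    evenSum-linear M f g h = begin
      evenSum M (λ i → f i + - (g i + h i))
        ≡⟨ Σ<-cong L (λ i → expand (ε i) ((M ℕ.+ M) Cℤ i) (f i) (g i) (h i)) ⟩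
      Σ< L (λ i → t f i + -1ℤ * (t g i + t h i))
        ≡⟨ Σ<-distrib-+ L (t f) _ ⟩
      evenSum M f + Σ< L (λ i → -1ℤ * (t g i + t h i))
        ≡⟨ cong (_+_ (evenSum M f)) (trans (*-distribˡ-Σ< L -1ℤ _) (ℤ.-1*i≡-i _)) ⟩
      evenSum M f + - Σ< L (λ i → t g i + t h i)
        ≡⟨ cong (λ z → evenSum M f + - z) (Σ<-distrib-+ L (t g) (t h)) ⟩
      evenSum M f + - (evenSum M g + evenSum M h) ∎
      where
      L : ℕ
      L = suc (M ℕ.+ M)
      t : (ℕ → ℤ) → ℕ → ℤ
      t f i = ε i * ((M ℕ.+ M) Cℤ i * f i)
      expand : ∀ e c x y z → e * (c * (x + - (y + z))) ≡ e * (c * x) + -1ℤ * (e * (c * y) + e * (c * z))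
      expand = solve-∀

    evenSum-Σ< : ∀ M n (w : ℕ → ℤ) (f : ℕ → ℕ → ℤ) →
      evenSum M (λ i → Σ< n (λ m → w m * f m i)) ≡ Σ< n (λ m → w m * evenSum M (f m))
    evenSum-Σ< M n w f = begin
      evenSum M (λ i → Σ< n (λ m → w m * f m i))
        ≡⟨ Σ<-cong L (λ i → trans (cong (ε i *_) (sym (*-distribˡ-Σ< n (c i) _))) (sym (*-distribˡ-Σ< n (ε i) _))) ⟩
      Σ< L (λ i → Σ< n (λ m → ε i * (c i * (w m * f m i))))
        ≡⟨ Σ<-comm L n _ ⟩
      Σ< n (λ m → Σ< L (λ i → ε i * (c i * (w m * f m i))))
        ≡⟨ Σ<-cong n (λ m → trans (Σ<-cong L λ i → alg (ε i) (c i) (w m) (f m i)) (*-distribˡ-Σ< L (w m) _)) ⟩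
      Σ< n (λ m → w m * evenSum M (f m)) ∎
      where
      L : ℕ
      L = suc (M ℕ.+ M)
      c : ℕ → ℤ
      c i = (M ℕ.+ M) Cℤ i
      alg : ∀ e c w x → e * (c * (w * x)) ≡ w * (e * (c * x))
      alg = solve-∀

    -- The top term has coefficient 1, so the sums `evenSum M f` for all M determine `f` at even
    -- arguments by strong induction.
    evenSum-split : ∀ M f → evenSum M f ≡ Σ< M (λ k → (M ℕ.+ M) Cℤ (k ℕ.+ k) * f (k ℕ.+ k)) + f (M ℕ.+ M)
    evenSum-split M f = begin
      evenSum M f
        ≡⟨ Σ<-last (M ℕ.+ M) t ⟩
      Σ< (M ℕ.+ M) t + t (M ℕ.+ M)
        ≡⟨ cong (_+ t (M ℕ.+ M)) (Σ<-pairs M t) ⟩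
      Σ< M (λ k → t (k ℕ.+ k)) + Σ< M (λ k → t (suc (k ℕ.+ k))) + t (M ℕ.+ M)
        ≡⟨ cong₂ (λ a b → a + b + t (M ℕ.+ M))
             (Σ<-cong M λ k → trans (cong (_* ct (k ℕ.+ k)) (ε-even k)) (ℤ.*-identityˡ (ct (k ℕ.+ k))))
             (Σ<-zero M _ λ k → cong (_* ct (suc (k ℕ.+ k))) (ε-odd k)) ⟩
      Σ< M (λ k → ct (k ℕ.+ k)) + 0ℤ + t (M ℕ.+ M)
        ≡⟨ cong₂ (λ e c → Σ< M (λ k → ct (k ℕ.+ k)) + 0ℤ + e * (c * f (M ℕ.+ M))) (ε-even M) (Cℤ-self (M ℕ.+ M)) ⟩
      Σ< M (λ k → ct (k ℕ.+ k)) + 0ℤ + 1ℤ * (1ℤ * f (M ℕ.+ M))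
        ≡⟨ alg (Σ< M (λ k → ct (k ℕ.+ k))) (f (M ℕ.+ M)) ⟩
      Σ< M (λ k → ct (k ℕ.+ k)) + f (M ℕ.+ M) ∎
      where
      ct t : ℕ → ℤ
      ct i = (M ℕ.+ M) Cℤ i * f i
      t i = ε i * ct i
      alg : ∀ x y → x + 0ℤ + 1ℤ * (1ℤ * y) ≡ x + y
      alg = solve-∀

    evenSum-0^ : ∀ M → evenSum M (0ℤ ^_) ≡ 1ℤ
    evenSum-0^ M = begin
      evenSum M (0ℤ ^_)
        ≡⟨ Σ<-first (M ℕ.+ M) _ ⟩
      1ℤ * ((M ℕ.+ M) Cℤ 0 * 1ℤ) + Σ< (M ℕ.+ M) (λ i → ε (suc i) * ((M ℕ.+ M) Cℤ suc i * 0ℤ))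
        ≡⟨ cong₂ (λ c s → 1ℤ * (c * 1ℤ) + s) (Cℤ-0 (M ℕ.+ M)) (Σ<-zero (M ℕ.+ M) _ λ i → alg (ε (suc i)) ((M ℕ.+ M) Cℤ suc i)) ⟩
      1ℤ ∎
      where
      alg : ∀ e c → e * (c * 0ℤ) ≡ 0ℤ
      alg = solve-∀

    -- The recursion pairs C(N,k) with E (N - k), so the order of summation is reversed; parity
    -- survives since N is even. The recursion starts at N = 1, and M = 0 gives the exceptional
    -- value 0^0 = 1.
    evenSum-E : ∀ M → evenSum M E ≡ 0ℤ ^ (M ℕ.+ M)
    evenSum-E zero    = trans (Σ<-first 0 _) (cong₂ (λ c s → 1ℤ * (c * 1ℤ) + s) (Cℤ-0 0) (Σ<-empty _))
    evenSum-E (suc M) = begin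
      evenSum (suc M) E
        ≡⟨ Σ<-∑ L (λ i → ε i * (N Cℤ i * E i)) ⟩
      ∑ℤ.sum {L} (λ i → ε (toℕ i) * (N Cℤ toℕ i * E (toℕ i)))
        ≡⟨ ∑ℤ.sum-permute {L} {L} (λ i → ε (toℕ i) * (N Cℤ toℕ i * E (toℕ i))) reverse ⟩
      ∑ℤ.sum {L} (λ i → ε (toℕ (opposite i)) * (N Cℤ toℕ (opposite i) * E (toℕ (opposite i))))
        ≡⟨ ∑ℤ.sum-cong-≗ {L} termwise ⟩
      ∑ℤ.sum {L} (λ k → evenOnly (toℕ k) (+ (N C toℕ k) * E (N ∸ toℕ k)))
        ≡⟨ E-recursion (M ℕ.+ suc M) ⟩
      0ℤ ∎
      where
      N L : ℕ
      N = suc M ℕ.+ suc M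
      L = suc N
      termwise : ∀ (i : Fin L) → ε (toℕ (opposite i)) * (N Cℤ toℕ (opposite i) * E (toℕ (opposite i)))
                               ≡ evenOnly (toℕ i) (+ (N C toℕ i) * E (N ∸ toℕ i))
      termwise i = begin
        ε (toℕ (opposite i)) * (N Cℤ toℕ (opposite i) * E (toℕ (opposite i)))
          ≡⟨ cong (λ j → ε j * (N Cℤ j * E j)) (opposite-prop i) ⟩
        ε (N ∸ k) * (N Cℤ (N ∸ k) * E (N ∸ k))
          ≡⟨ cong₂ (λ e c → e * (c * E (N ∸ k))) (ε-reflect (suc M) (N ∸ k) k (ℕ.m∸n+n≡m k≤N))
               (trans (Cℤ-C N (N ∸ k)) (cong +_ (sym (nCk≡nC[n∸k] k≤N)))) ⟩
        ε k * (+ (N C k) * E (N ∸ k))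
          ≡⟨ evenOnly-ε k _ ⟨
        evenOnly k (+ (N C k) * E (N ∸ k)) ∎
        where
        k : ℕ
        k = toℕ i
        k≤N : k ≤ N
        k≤N = ℕ.s≤s⁻¹ (toℕ<n i)

  open Integers

  -- Congruences of integers modulo p and Fermat's little theorem.

  module Congruence (p : ℕ) where

    infix 4 _≈_
    -- The equation is solved for x, so that matching it with `refl` eliminates x and every closure
    -- property becomes a polynomial identity with an explicit quotient.
    record _≈_ (x y : ℤ) : Set where
      constructor _by_
      field
        quotient : ℤ
        equality : x ≡ y + quotient * + p

    ≡⇒≈ : ∀ {x y} → x ≡ y → x ≈ y
    ≡⇒≈ {x} refl = 0ℤ by alg x (+ p)
      where
      alg : ∀ x P → x ≡ x + 0ℤ * P
      alg = solve-∀

    ≈-refl : ∀ {x} → x ≈ x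
    ≈-refl = ≡⇒≈ refl

    ≈-sym : ∀ {x y} → x ≈ y → y ≈ x
    ≈-sym {y = y} (a by refl) = (- a) by alg y a (+ p)
      where
      alg : ∀ y a P → y ≡ y + a * P + - a * P
      alg = solve-∀

    ≈-trans : ∀ {x y z} → x ≈ y → y ≈ z → x ≈ z
    ≈-trans {z = z} (a by refl) (b by refl) = (a + b) by alg z a b (+ p)
      where
      alg : ∀ z a b P → z + b * P + a * P ≡ z + (a + b) * P
      alg = solve-∀

    ≈-setoid : Setoid _ _
    ≈-setoid = record
      { Carrier       = ℤ
      ; _≈_           = _≈_
      ; isEquivalence = record { refl = ≈-refl ; sym = ≈-sym ; trans = ≈-trans }
      }

    module ≈-Reasoning = Relation.Binary.Reasoning.Setoid ≈-setoid

    +-cong : ∀ {x y u v} → x ≈ y → u ≈ v → x + u ≈ y + v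
    +-cong {y = y} {v = v} (a by refl) (b by refl) = (a + b) by alg y v a b (+ p)
      where
      alg : ∀ y v a b P → y + a * P + (v + b * P) ≡ y + v + (a + b) * P
      alg = solve-∀

    +-congˡ : ∀ x {u v} → u ≈ v → x + u ≈ x + v
    +-congˡ x = +-cong (≈-refl {x})

    +-congʳ : ∀ x {u v} → u ≈ v → u + x ≈ v + x
    +-congʳ x u≈v = +-cong u≈v (≈-refl {x})

    *-cong : ∀ {x y u v} → x ≈ y → u ≈ v → x * u ≈ y * v
    *-cong {y = y} {v = v} (a by refl) (b by refl) =
      (y * b + a * v + a * b * + p) by alg y v a b (+ p)
      where
      alg : ∀ y v a b P → (y + a * P) * (v + b * P) ≡ y * v + (y * b + a * v + a * b * P) * P
      alg = solve-∀

    *-congˡ : ∀ x {u v} → u ≈ v → x * u ≈ x * v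
    *-congˡ x = *-cong (≈-refl {x})

    *-congʳ : ∀ x {u v} → u ≈ v → u * x ≈ v * x
    *-congʳ x u≈v = *-cong u≈v (≈-refl {x})

    -‿cong : ∀ {x y} → x ≈ y → - x ≈ - y
    -‿cong {y = y} (a by refl) = (- a) by alg y a (+ p)
      where
      alg : ∀ y a P → - (y + a * P) ≡ - y + - a * P
      alg = solve-∀

    ^-cong : ∀ n {x y} → x ≈ y → x ^ n ≈ y ^ n
    ^-cong zero    x≈y = ≈-refl
    ^-cong (suc n) x≈y = *-cong x≈y (^-cong n x≈y)

    *p≈0 : ∀ x → x * + p ≈ 0ℤ
    *p≈0 x = x by sym (ℤ.+-identityˡ (x * + p))

    Σ<-cong-≈ : ∀ n {f g} → (∀ i → i < n → f i ≈ g i) → Σ< n f ≈ Σ< n g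
    Σ<-cong-≈ zero    f≈g = ≡⇒≈ (trans (Σ<-empty _) (sym (Σ<-empty _)))
    Σ<-cong-≈ (suc n) {f} {g} f≈g = begin
      Σ< (suc n) f             ≡⟨ Σ<-first n f ⟩
      f 0 + Σ< n (f ∘ suc)     ≈⟨ +-cong (f≈g 0 z<s) (Σ<-cong-≈ n λ i i<n → f≈g (suc i) (s<s i<n)) ⟩
      g 0 + Σ< n (g ∘ suc)     ≡⟨ Σ<-first n g ⟨
      Σ< (suc n) g             ∎
      where open ≈-Reasoning

    Σ<-≈0 : ∀ n {f} → (∀ i → i < n → f i ≈ 0ℤ) → Σ< n f ≈ 0ℤ
    Σ<-≈0 n f≈0 = ≈-trans (Σ<-cong-≈ n f≈0) (≡⇒≈ (Σ<-zero n (λ _ → 0ℤ) λ _ → refl))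

    -- The first term of `f` is peeled off against the last of `g`, so reversal and termwise
    -- congruence happen at once. Mirrored indices are given by i + j + 1 = n, which avoids
    -- truncated subtraction.
    Σ<-reverse : ∀ n {f g} → (∀ i j → suc (i ℕ.+ j) ≡ n → f i ≈ g j) → Σ< n f ≈ Σ< n g
    Σ<-reverse zero    f≈g = ≡⇒≈ (trans (Σ<-empty _) (sym (Σ<-empty _)))
    Σ<-reverse (suc n) {f} {g} f≈g = begin
      Σ< (suc n) f             ≡⟨ Σ<-first n f ⟩
      f 0 + Σ< n (f ∘ suc)     ≈⟨ +-cong (f≈g 0 n refl) (Σ<-reverse n λ i j eq → f≈g (suc i) j (cong suc eq)) ⟩
      g n + Σ< n g             ≡⟨ ℤ.+-comm (g n) _ ⟩
      Σ< n g + g n             ≡⟨ Σ<-last n g ⟨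
      Σ< (suc n) g             ∎
      where open ≈-Reasoning

    module _ (p-prime : Prime p) where

      -- The substitute for division: p divides a (x - y), but a lies strictly between 0 and p, so
      -- Euclid's lemma leaves p dividing x - y.
      *-cancelˡ : ∀ {a x y} → 0 < a → a < p → + a * x ≈ + a * y → x ≈ y
      *-cancelˡ {a} {x} {y} 0<a a<p (c by ax≡ay+cp) =
        case euclidsLemma a ∣ x + - y ∣ p-prime (ℕ.divides ∣ c ∣ abs-eq) of λ where
          (inj₁ p∣a)   → contradiction a<p (ℕ.≤⇒≯ (ℕ.∣⇒≤ {{ℕ.>-nonZero 0<a}} p∣a))
          (inj₂ p∣x-y) → lift (Signed.∣ᵤ⇒∣ {+ p} {x + - y} p∣x-y)
        where
        expand : ∀ a x y → a * (x + - y) ≡ a * x + - (a * y)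
        expand = solve-∀
        cancel : ∀ ay cp → ay + cp + - ay ≡ cp
        cancel = solve-∀
        split : ∀ x y → x ≡ y + (x + - y)
        split = solve-∀
        lift : + p Signed.∣ x + - y → x ≈ y
        lift (Signed.divides d x-y≡dp) = d by trans (split x y) (cong (_+_ y) x-y≡dp)
        abs-eq : a ℕ.* ∣ x + - y ∣ ≡ ∣ c ∣ ℕ.* p
        abs-eq = begin
          a ℕ.* ∣ x + - y ∣              ≡⟨ ℤ.abs-* (+ a) (x + - y) ⟨
          ∣ + a * (x + - y) ∣            ≡⟨ cong ∣_∣ (expand (+ a) x y) ⟩
          ∣ + a * x + - (+ a * y) ∣      ≡⟨ cong (λ z → ∣ z + - (+ a * y) ∣) ax≡ay+cp ⟩
          ∣ + a * y + c * + p + - (+ a * y) ∣  ≡⟨ cong ∣_∣ (cancel (+ a * y) (c * + p)) ⟩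
          ∣ c * + p ∣                    ≡⟨ ℤ.abs-* c (+ p) ⟩
          ∣ c ∣ ℕ.* p                    ∎
          where open ≡-Reasoning

      C[p,k+1]≈0 : ∀ r k → p ≡ suc r → suc k < p → p Cℤ suc k ≈ 0ℤ
      C[p,k+1]≈0 r k refl k+1<p = *-cancelˡ {suc k} z<s k+1<p (begin
        (1ℤ + + k) * suc r Cℤ suc k   ≡⟨ Cℤ-absorb-suc r k ⟩
        + suc r * r Cℤ k              ≡⟨ ℤ.*-comm (+ suc r) (r Cℤ k) ⟩
        r Cℤ k * + suc r              ≈⟨ *p≈0 (r Cℤ k) ⟩
        0ℤ                            ≡⟨ ℤ.*-zeroʳ (1ℤ + + k) ⟨
        (1ℤ + + k) * 0ℤ               ∎)
        where open ≈-Reasoning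

      -- Induction on a by the binomial theorem, whose interior coefficients vanish modulo p. The
      -- argument `r` exposes p as a successor, so that the two outer terms can be split off.
      fermat : ∀ r a → p ≡ suc r → (+ a) ^ p ≈ + a
      fermat r zero    refl = ≡⇒≈ refl
      fermat r (suc a) refl = begin
        (1ℤ + + a) ^ suc r
          ≡⟨ binomial-theorem (suc r) (+ a) ⟩
        Σ< (suc (suc r)) term
          ≡⟨ Σ<-last (suc r) term ⟩
        Σ< (suc r) term + term (suc r)
          ≡⟨ cong (_+ term (suc r)) (Σ<-first r term) ⟩
        term 0 + Σ< r (term ∘ suc) + term (suc r)
          ≈⟨ +-cong (+-congˡ (term 0) (Σ<-≈0 r λ k k<r → *-congʳ ((+ a) ^ suc k) (C[p,k+1]≈0 r k refl (s<s k<r))))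
                    (≡⇒≈ (cong (_* (+ a) ^ suc r) (Cℤ-self (suc r)))) ⟩
        term 0 + 0ℤ + 1ℤ * (+ a) ^ suc r
          ≡⟨ cong (λ c → c * 1ℤ + 0ℤ + 1ℤ * (+ a) ^ suc r) (Cℤ-0 (suc r)) ⟩
        1ℤ + 1ℤ * (+ a) ^ suc r
          ≡⟨ cong (_+_ 1ℤ) (ℤ.*-identityˡ ((+ a) ^ suc r)) ⟩
        1ℤ + (+ a) ^ suc r
          ≈⟨ +-congˡ 1ℤ (fermat r a refl) ⟩
        1ℤ + + a ∎
        where
        open ≈-Reasoning
        term : ℕ → ℤ
        term k = suc r Cℤ k * (+ a) ^ k

  -- Residues of p-integral rationals.

  module Residues {p : ℕ} (p-prime : Prime p) where
    open Congruence p

    ∤-* : ∀ {a b} → ¬ p ℕ.∣ a → ¬ p ℕ.∣ b → ¬ p ℕ.∣ a ℕ.* b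
    ∤-* {a} {b} p∤a p∤b p∣ab = case euclidsLemma a b p-prime p∣ab of λ where
      (inj₁ p∣a) → p∤a p∣a
      (inj₂ p∣b) → p∤b p∣b

    ∤-< : ∀ {a} → 0 < a → a < p → ¬ p ℕ.∣ a
    ∤-< 0<a a<p p∣a = contradiction a<p (ℕ.≤⇒≯ (ℕ.∣⇒≤ {{ℕ.>-nonZero 0<a}} p∣a))

    ∤-1 : ¬ p ℕ.∣ 1
    ∤-1 = ∤-< z<s (ℕ.nonTrivial⇒n>1 p {{prime⇒nonTrivial p-prime}})

    ∤-^ : ∀ {a} k → ¬ p ℕ.∣ a → ¬ p ℕ.∣ a ℕ.^ k
    ∤-^ zero    p∤a = ∤-1
    ∤-^ (suc k) p∤a = ∤-* p∤a (∤-^ k p∤a)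

    -- x ↦ a: the rational x is p-integral with image a in ℤ/p.
    infix 4 _↦_
    record _↦_ (x : ℚ) (a : ℤ) : Set where
      constructor via
      field
        fraction     : ℚᵘ
        represents   : toℚᵘ x ℚᵘ.≃ fraction
        p∤denominator : ¬ p ℕ.∣ ℚᵘ.↧ₙ fraction
        residue      : ℚᵘ.↥ fraction ≈ a * ℚᵘ.↧ fraction

    ↦-/ : ∀ m d .{{_ : ℕ.NonZero d}} {a} → ¬ p ℕ.∣ d → m ≈ a * + d → m / d ↦ a
    ↦-/ m (suc d-1) p∤d m≈ad = via (mkℚᵘ m d-1) (ℚ.toℚᵘ-fromℚᵘ (mkℚᵘ m d-1)) p∤d m≈ad

    ↦-int : ∀ a → a / 1 ↦ a
    ↦-int a = ↦-/ a 1 ∤-1 (≡⇒≈ (sym (ℤ.*-identityʳ a)))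

    ↦-+ : ∀ {x y a b} → x ↦ a → y ↦ b → x ℚ.+ y ↦ a + b
    ↦-+ {x} {y} {a} {b} (via f@(mkℚᵘ k c) x≃f p∤f f≈a) (via g@(mkℚᵘ l d) y≃g p∤g g≈b) =
      via (f ℚᵘ.+ g)
          (ℚᵘ.≃-trans (ℚ.toℚᵘ-homo-+ x y) (ℚᵘ.+-cong x≃f y≃g))
          (∤-* p∤f p∤g)
          (≈-trans (+-cong (*-congʳ (+ suc d) f≈a) (*-congʳ (+ suc c) g≈b))
                   (≡⇒≈ (trans (alg a b (+ suc c) (+ suc d)) (cong ((a + b) *_) (sym (ℤ.pos-* (suc c) (suc d)))))))
      where
      alg : ∀ a b c d → a * c * d + b * d * c ≡ (a + b) * (c * d)
      alg = solve-∀

    ↦-* : ∀ {x y a b} → x ↦ a → y ↦ b → x ℚ.* y ↦ a * b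
    ↦-* {x} {y} {a} {b} (via f@(mkℚᵘ k c) x≃f p∤f f≈a) (via g@(mkℚᵘ l d) y≃g p∤g g≈b) =
      via (f ℚᵘ.* g)
          (ℚᵘ.≃-trans (ℚ.toℚᵘ-homo-* x y) (ℚᵘ.*-cong x≃f y≃g))
          (∤-* p∤f p∤g)
          (≈-trans (*-cong f≈a g≈b)
                   (≡⇒≈ (trans (alg a b (+ suc c) (+ suc d)) (cong (a * b *_) (sym (ℤ.pos-* (suc c) (suc d)))))))
      where
      alg : ∀ a b c d → a * c * (b * d) ≡ a * b * (c * d)
      alg = solve-∀

    ↦-neg : ∀ {x a} → x ↦ a → ℚ.- x ↦ - a
    ↦-neg {x} {a} (via f@(mkℚᵘ k c) x≃f p∤f f≈a) =
      via (ℚᵘ.- f) (ℚᵘ.≃-trans (ℚ.toℚᵘ-homo‿- x) (ℚᵘ.-‿cong x≃f)) p∤f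
          (≈-trans (-‿cong f≈a) (≡⇒≈ (ℤ.neg-distribˡ-* a (+ suc c))))

    ↦-Σ< : ∀ n (f : Fin n → ℚ) (g : ℕ → ℤ) → (∀ i → f i ↦ g (toℕ i)) → ∑ℚ.sum f ↦ Σ< n g
    ↦-Σ< zero    f g f↦g = subst (0ℚ ↦_) (sym (Σ<-empty g)) (↦-int 0ℤ)
    ↦-Σ< (suc n) f g f↦g =
      subst (∑ℚ.sum f ↦_) (sym (Σ<-first n g)) (↦-+ (f↦g zero) (↦-Σ< n (f ∘ suc) (g ∘ suc) (f↦g ∘ suc)))

    -- A reduced denominator is coprime to its numerator and hence divides the denominator of every
    -- fraction representing the same number. Thus residues may be computed with unreduced
    -- fractions.
    integral : ∀ x f → toℚᵘ x ℚᵘ.≃ f → ¬ p ℕ.∣ ℚᵘ.↧ₙ f → p -Integral x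
    integral (mkℚ m d-1 m⊥d) (mkℚᵘ k c) (*≡* mf≡kd) p∤f p∣d = p∤f (ℕ.∣-trans p∣d d∣f)
      where
      d∣mf : suc d-1 ℕ.∣ ∣ m ∣ ℕ.* suc c
      d∣mf = ℕ.divides ∣ k ∣ (trans (sym (ℤ.abs-* m (+ suc c))) (trans (cong ∣_∣ mf≡kd) (ℤ.abs-* k (+ suc d-1))))
      d∣f : suc d-1 ℕ.∣ suc c
      d∣f = Coprimality.coprime-divisor (Coprimality.sym (Coprimality.recompute m⊥d)) d∣mf

    ↦⇒integral : ∀ {x a} → x ↦ a → p -Integral x
    ↦⇒integral {x} (via f x≃f p∤f _) = integral x f x≃f p∤f

    -- Residue zero makes the numerator `l * + p`; the cofactor keeps the same denominator.
    ↦0⇒multiple : ∀ {x} → x ↦ 0ℤ → ∃[ z ] (p -Integral z × x ≡ (+ p / 1) ℚ.* z)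
    ↦0⇒multiple {x} (via f@(mkℚᵘ .(0ℤ * + suc c + l * + p) c) x≃f p∤f (l by refl)) =
      l / suc c , integral (l / suc c) (mkℚᵘ l c) (ℚ.toℚᵘ-fromℚᵘ (mkℚᵘ l c)) p∤f , ℚ.toℚᵘ-injective (begin
        toℚᵘ x                                      ≈⟨ x≃f ⟩
        f                                           ≈⟨ *≡* (trans (cong ((0ℤ + l * + p) *_) (ℤ.pos-* 1 (suc c))) (alg l (+ p) (+ suc c))) ⟩
        mkℚᵘ (+ p) 0 ℚᵘ.* mkℚᵘ l c                  ≈⟨ ℚᵘ.*-cong (ℚ.toℚᵘ-fromℚᵘ (mkℚᵘ (+ p) 0)) (ℚ.toℚᵘ-fromℚᵘ (mkℚᵘ l c)) ⟨
        toℚᵘ (+ p / 1) ℚᵘ.* toℚᵘ (l / suc c)        ≈⟨ ℚ.toℚᵘ-homo-* (+ p / 1) (l / suc c) ⟨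
        toℚᵘ (+ p / 1 ℚ.* (l / suc c))              ∎)
      where
      open ℚᵘ.≃-Reasoning
      alg : ∀ l P c → (0ℤ + l * P) * (1ℤ * c) ≡ P * l * c
      alg = solve-∀

    ↦-resp-≈ : ∀ {x a b} → a ≈ b → x ↦ a → x ↦ b
    ↦-resp-≈ a≈b (via f x≃f p∤f f≈a) = via f x≃f p∤f (≈-trans f≈a (*-congʳ (ℚᵘ.↧ f) a≈b))

    ↦⇒≡mod : ∀ {x y a b} → x ↦ a → y ↦ b → a ≈ b → x ≡ y [mod p ]
    ↦⇒≡mod {b = b} x↦a y↦b a≈b =
      ↦⇒integral x↦a , ↦⇒integral y↦b ,
      ↦0⇒multiple (↦-resp-≈ (≈-trans (+-congʳ (- b) a≈b) (≡⇒≈ (ℤ.+-inverseʳ b))) (↦-+ x↦a (↦-neg y↦b)))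

  -- The case p = 2n + 1 with n = q + 1, where p - 3 = 2q.

  module OddPrime (q : ℕ) (p-prime : Prime (suc (suc q ℕ.+ suc q))) where

    n p : ℕ
    n = suc q
    p = suc (n ℕ.+ n)

    N : ℤ
    N = + n

    open Congruence p
    open Residues p-prime
    open ≈-Reasoning

    ν : ℤ → ℤ
    ν x = x ^ (q ℕ.+ q)

    -- Fermat's congruence for a^p = a (a² a^(p-3)), with one factor a cancelled.
    ν-inverse : ∀ {a} → 0 < a → a < p → + a * + a * ν (+ a) ≈ 1ℤ
    ν-inverse {a} 0<a a<p = *-cancelˡ p-prime 0<a a<p (begin
      + a * (+ a * + a * ν (+ a))          ≡⟨ cong (+ a *_) (ℤ.*-assoc (+ a) (+ a) _) ⟩
      (+ a) ^ suc (suc (suc (q ℕ.+ q)))    ≡⟨ cong (λ k → (+ a) ^ suc (suc k)) (ℕ.+-suc q q) ⟨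
      (+ a) ^ p                            ≈⟨ fermat p-prime (n ℕ.+ n) a refl ⟩
      + a                                  ≡⟨ ℤ.*-identityʳ (+ a) ⟨
      + a * 1ℤ                             ∎)

    odd<p : ∀ {m} → m < n → suc (m ℕ.+ m) < p
    odd<p m<n = s<s (ℕ.+-mono-< m<n m<n)

    even<p : ∀ {m} → m < n → suc (suc (m ℕ.+ m)) < p
    even<p {m} m<n = s≤s (subst (_≤ n ℕ.+ n) (cong suc (ℕ.+-suc m m)) (ℕ.+-mono-≤ m<n m<n))

    -- Binomial coefficients modulo p.

    -- Both sides have the same ratio of consecutive terms modulo p. For k < n the factors 2k + 1
    -- and 2k + 2 are below p and can be cancelled.
    4^kC[n+k,2k]≈C[n,k] : ∀ k → k ≤ n → (+ 4) ^ k * (n ℕ.+ k) Cℤ (k ℕ.+ k) ≈ n Cℤ k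
    4^kC[n+k,2k]≈C[n,k] zero    _   = ≡⇒≈ (trans (ℤ.*-identityˡ _) (trans (Cℤ-0 (n ℕ.+ 0)) (sym (Cℤ-0 n))))
    4^kC[n+k,2k]≈C[n,k] (suc k) k<n =
      *-cancelˡ p-prime z<s (odd<p k<n) (*-cancelˡ p-prime z<s (even<p k<n) (begin
        d * (c * (+ 4 * X * C₁))
          ≡⟨ alg₁ c d X C₁ ⟩
        + 4 * X * (c * d * C₁)
          ≡⟨ cong (+ 4 * X *_) (C[m+k,2k]-step n k) ⟩
        + 4 * X * ((N + K + 1ℤ) * (N + - K) * C₀)
          ≡⟨ alg₂ N K X C₀ ⟩
        + 4 * (N + K + 1ℤ) * (N + - K) * (X * C₀)
          ≈⟨ *-congˡ (+ 4 * (N + K + 1ℤ) * (N + - K)) (4^kC[n+k,2k]≈C[n,k] k (ℕ.<⇒≤ k<n)) ⟩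
        + 4 * (N + K + 1ℤ) * (N + - K) * n Cℤ k
          -- The quotient comes from 2 (n + k + 1) = (2k + 1) + p.
          ≈⟨ (+ 2 * (N + - K) * n Cℤ k) by alg₃ N K (n Cℤ k) ⟩
        + 2 * c * ((N + - K) * n Cℤ k)
          ≡⟨ cong (+ 2 * c *_) (Cℤ-absorb n k) ⟨
        + 2 * c * ((1ℤ + K) * n Cℤ suc k)
          ≡⟨ alg₄ K (n Cℤ suc k) ⟩
        d * (c * n Cℤ suc k) ∎))
      where
      K = + k
      X = (+ 4) ^ k
      c = 1ℤ + (K + K)
      d = + 2 + (K + K)
      C₀ = (n ℕ.+ k) Cℤ (k ℕ.+ k)
      C₁ = (n ℕ.+ suc k) Cℤ (suc k ℕ.+ suc k)
      alg₁ : ∀ c d X x → d * (c * (+ 4 * X * x)) ≡ + 4 * X * (c * d * x)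
      alg₁ = solve-∀
      alg₂ : ∀ N K X x → + 4 * X * ((N + K + 1ℤ) * (N + - K) * x) ≡ + 4 * (N + K + 1ℤ) * (N + - K) * (X * x)
      alg₂ = solve-∀
      alg₃ : ∀ N K b → + 4 * (N + K + 1ℤ) * (N + - K) * b
        ≡ + 2 * (1ℤ + (K + K)) * ((N + - K) * b) + + 2 * (N + - K) * b * (1ℤ + (N + N))
      alg₃ = solve-∀
      alg₄ : ∀ K b → + 2 * (1ℤ + (K + K)) * ((1ℤ + K) * b) ≡ (+ 2 + (K + K)) * ((1ℤ + (K + K)) * b)
      alg₄ = solve-∀

    -- This is C(2k,k) = (-4)^k C(-1/2,k), with n standing for -1/2. For n < k < p both sides are
    -- zero modulo p.
    C[2k,k]≈[-4]^kC[n,k] : ∀ k → k < p → (k ℕ.+ k) Cℤ k ≈ (- + 4) ^ k * n Cℤ k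
    C[2k,k]≈[-4]^kC[n,k] zero    _     = ≡⇒≈ (trans (Cℤ-0 0) (sym (trans (ℤ.*-identityˡ _) (Cℤ-0 n))))
    C[2k,k]≈[-4]^kC[n,k] (suc k) k+1<p = *-cancelˡ p-prime z<s k+1<p (begin
      (1ℤ + K) * (suc k ℕ.+ suc k) Cℤ suc k
        ≡⟨ C[2k,k]-step k ⟩
      + 2 * ((1ℤ + (K + K)) * (k ℕ.+ k) Cℤ k)
        ≈⟨ *-congˡ (+ 2) (*-congˡ (1ℤ + (K + K)) (C[2k,k]≈[-4]^kC[n,k] k (ℕ.<⇒≤ k+1<p))) ⟩
      + 2 * ((1ℤ + (K + K)) * (Y * n Cℤ k))
        ≈⟨ (+ 2 * (Y * n Cℤ k)) by alg₁ N K Y (n Cℤ k) ⟩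
      - + 4 * Y * ((N + - K) * n Cℤ k)
        ≡⟨ cong (- + 4 * Y *_) (Cℤ-absorb n k) ⟨
      - + 4 * Y * ((1ℤ + K) * n Cℤ suc k)
        ≡⟨ alg₂ K Y (n Cℤ suc k) ⟩
      (1ℤ + K) * (- + 4 * Y * n Cℤ suc k) ∎)
      where
      K = + k
      Y = (- + 4) ^ k
      alg₁ : ∀ N K Y b → + 2 * ((1ℤ + (K + K)) * (Y * b))
        ≡ - + 4 * Y * ((N + - K) * b) + + 2 * (Y * b) * (1ℤ + (N + N))
      alg₁ = solve-∀
      alg₂ : ∀ K Y b → - + 4 * Y * ((1ℤ + K) * b) ≡ (1ℤ + K) * (- + 4 * Y * b)
      alg₂ = solve-∀

    -- Here -2 (n - k) ≡ 2k + 1. The right side contains the hockey-stick value that appears in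
    -- `W-step`.
    C[n,k]≈-2·4^kC[n+k,2k+1] : ∀ k → k < n → n Cℤ k ≈ - + 2 * ((+ 4) ^ k * (n ℕ.+ k) Cℤ suc (k ℕ.+ k))
    C[n,k]≈-2·4^kC[n+k,2k+1] k k<n = *-cancelˡ p-prime z<s (odd<p k<n) (begin
      c * n Cℤ k
        ≈⟨ (n Cℤ k) by alg₁ N K (n Cℤ k) ⟩
      - + 2 * (N + - K) * n Cℤ k
        ≈⟨ *-congˡ (- + 2 * (N + - K)) (4^kC[n+k,2k]≈C[n,k] k (ℕ.<⇒≤ k<n)) ⟨
      - + 2 * (N + - K) * (X * C₀)
        ≡⟨ alg₂ (N + - K) X C₀ ⟩
      - + 2 * (X * ((N + - K) * C₀))
        ≡⟨ cong (λ z → - + 2 * (X * z)) (C[m+k,2k+1]-step n k) ⟨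
      - + 2 * (X * (c * (n ℕ.+ k) Cℤ suc (k ℕ.+ k)))
        ≡⟨ alg₃ c X ((n ℕ.+ k) Cℤ suc (k ℕ.+ k)) ⟩
      c * (- + 2 * (X * (n ℕ.+ k) Cℤ suc (k ℕ.+ k))) ∎)
      where
      K = + k
      X = (+ 4) ^ k
      c = 1ℤ + (K + K)
      C₀ = (n ℕ.+ k) Cℤ (k ℕ.+ k)
      alg₁ : ∀ N K b → (1ℤ + (K + K)) * b ≡ - + 2 * (N + - K) * b + b * (1ℤ + (N + N))
      alg₁ = solve-∀
      alg₂ : ∀ t X x → - + 2 * t * (X * x) ≡ - + 2 * (X * (t * x))
      alg₂ = solve-∀
      alg₃ : ∀ c X x → - + 2 * (X * (c * x)) ≡ c * (- + 2 * (X * x))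
      alg₃ = solve-∀

    -- The first-order recursion for the harmonic sums.

    W : ℕ → ℤ
    W k = Σ< n (λ m → (m ℕ.+ k) Cℤ (k ℕ.+ k) * ν (+ suc (m ℕ.+ m)))

    -- Multiplying C(m+k,2k) by (2m + 1)² - (2k + 1)² = 4 (m + k + 1) (m - k) raises k,
    -- and (2m + 1)² cancels against ν (2m + 1), leaving a hockey-stick sum.
    W-step : ∀ k → + 4 * ((1ℤ + (+ k + + k)) * (+ 2 + (+ k + + k))) * W (suc k)
                 ≈ (n ℕ.+ k) Cℤ suc (k ℕ.+ k) + - ((1ℤ + (+ k + + k)) * (1ℤ + (+ k + + k))) * W k
    W-step k = begin
      + 4 * (c * d) * W (suc k)
        ≡⟨ *-distribˡ-Σ< n (+ 4 * (c * d)) _ ⟨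
      Σ< n (λ m → + 4 * (c * d) * ((m ℕ.+ suc k) Cℤ (suc k ℕ.+ suc k) * ν (+ suc (m ℕ.+ m))))
        ≈⟨ Σ<-cong-≈ n termwise ⟩
      Σ< n (λ m → C₀ m + - (c * c) * (C₀ m * ν (+ suc (m ℕ.+ m))))
        ≡⟨ Σ<-distrib-+ n C₀ _ ⟩
      Σ< n C₀ + Σ< n (λ m → - (c * c) * (C₀ m * ν (+ suc (m ℕ.+ m))))
        ≡⟨ cong₂ _+_ (hockey-stick n k) (*-distribˡ-Σ< n (- (c * c)) _) ⟩
      (n ℕ.+ k) Cℤ suc (k ℕ.+ k) + - (c * c) * W k ∎
      where
      K = + k
      c = 1ℤ + (K + K)
      d = + 2 + (K + K)
      C₀ : ℕ → ℤ
      C₀ m = (m ℕ.+ k) Cℤ (k ℕ.+ k)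
      alg₁ : ∀ e x v → + 4 * e * (x * v) ≡ + 4 * (e * x) * v
      alg₁ = solve-∀
      alg₂ : ∀ M K x v → + 4 * ((M + K + 1ℤ) * (M + - K) * x) * v
        ≡ x * ((1ℤ + (M + M)) * (1ℤ + (M + M)) * v) + - ((1ℤ + (K + K)) * (1ℤ + (K + K))) * (x * v)
      alg₂ = solve-∀
      termwise : ∀ m → m < n → + 4 * (c * d) * ((m ℕ.+ suc k) Cℤ (suc k ℕ.+ suc k) * ν (+ suc (m ℕ.+ m)))
                             ≈ C₀ m + - (c * c) * (C₀ m * ν (+ suc (m ℕ.+ m)))
      termwise m m<n = begin
        + 4 * (c * d) * ((m ℕ.+ suc k) Cℤ (suc k ℕ.+ suc k) * v)
          ≡⟨ alg₁ (c * d) ((m ℕ.+ suc k) Cℤ (suc k ℕ.+ suc k)) v ⟩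
        + 4 * (c * d * (m ℕ.+ suc k) Cℤ (suc k ℕ.+ suc k)) * v
          ≡⟨ cong (λ z → + 4 * z * v) (C[m+k,2k]-step m k) ⟩
        + 4 * ((+ m + K + 1ℤ) * (+ m + - K) * C₀ m) * v
          ≡⟨ alg₂ (+ m) K (C₀ m) v ⟩
        C₀ m * (s * s * v) + - (c * c) * (C₀ m * v)
          ≈⟨ +-congʳ (- (c * c) * (C₀ m * v)) (*-congˡ (C₀ m) (ν-inverse z<s (odd<p m<n))) ⟩
        C₀ m * 1ℤ + - (c * c) * (C₀ m * v)
          ≡⟨ cong (_+ - (c * c) * (C₀ m * v)) (ℤ.*-identityʳ (C₀ m)) ⟩
        C₀ m + - (c * c) * (C₀ m * v) ∎
        where
        s = + suc (m ℕ.+ m)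
        v = ν s

    W-n≈0 : W n ≈ 0ℤ
    W-n≈0 = Σ<-≈0 n λ m m<n → ≡⇒≈ (cong (_* ν (+ suc (m ℕ.+ m))) (Cℤ-zero (ℕ.+-monoˡ-< n m<n)))

    h : ℕ → ℤ
    h j = Σ< j (λ i → ν (+ suc i))

    -- At j = 0 both sides vanish. In the step, the increment of `h` contributes 4 C(n,k) ≡ -8 · 4^k
    -- `B`, which must cancel the inhomogeneous term `B` of `W-step`; this forces the constant -8.
    C[n,j]h[j]≈-8·4^kW[k] : ∀ j k → j ℕ.+ k ≡ n → n Cℤ j * h j ≈ - + 8 * ((+ 4) ^ k * W k)
    C[n,j]h[j]≈-8·4^kW[k] zero .n refl = begin
      n Cℤ 0 * h 0                 ≡⟨ cong (n Cℤ 0 *_) (Σ<-empty _) ⟩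
      n Cℤ 0 * 0ℤ                  ≡⟨ alg (n Cℤ 0) ((+ 4) ^ n) ⟩
      - + 8 * ((+ 4) ^ n * 0ℤ)     ≈⟨ *-congˡ (- + 8) (*-congˡ ((+ 4) ^ n) W-n≈0) ⟨
      - + 8 * ((+ 4) ^ n * W n)    ∎
      where
      alg : ∀ x y → x * 0ℤ ≡ - + 8 * (y * 0ℤ)
      alg = solve-∀
    C[n,j]h[j]≈-8·4^kW[k] (suc j) k 1+j+k≡n =
      *-cancelˡ p-prime z<s (odd<p k<n) (*-cancelˡ p-prime z<s (odd<p k<n) (begin
        c * (c * (a′ * h (suc j)))
          ≡⟨ cong (λ z → c * (c * (a′ * z))) (Σ<-last j _) ⟩
        c * (c * (a′ * (h j + v)))
          ≡⟨ alg₁ c a′ (h j) v ⟩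
        c * (c * (a′ * h j)) + c * (c * (a′ * v))
          -- In the first product only one `c` is replaced, since the other joins 2 (n - j) = 2 (k +
          -- 1) = `d` to form the `c * d` of `W-step`. In the second product both are replaced, and
          -- the resulting square cancels `v`.
          ≈⟨ +-cong (*-congˡ c (*-congʳ (a′ * h j) c≈)) (*-cong c≈ (*-congʳ (a′ * v) c≈)) ⟩
        c * (t * (a′ * h j)) + t * (t * (a′ * v))
          ≡⟨ alg₂ c (1ℤ + J) a′ (h j) v ⟩
        - + 2 * c * ((1ℤ + J) * a′) * h j + + 4 * a′ * ((1ℤ + J) * (1ℤ + J) * v)
          ≈⟨ +-cong (≡⇒≈ (cong (λ z → - + 2 * c * z * h j) (Cℤ-absorb n j)))
                    (*-congˡ (+ 4 * a′) (ν-inverse z<s j+1<p)) ⟩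
        - + 2 * c * ((N + - J) * a) * h j + + 4 * a′ * 1ℤ
          ≡⟨ cong₂ (λ y z → - + 2 * c * ((y + - J) * a) * h j + + 4 * z * 1ℤ) N≡ a′≡ ⟩
        - + 2 * c * ((1ℤ + J + K + - J) * a) * h j + + 4 * n Cℤ k * 1ℤ
          ≡⟨ alg₃ J K a (h j) (n Cℤ k) ⟩
        - (c * d) * (a * h j) + + 4 * n Cℤ k
          ≈⟨ +-cong (*-congˡ (- (c * d)) (C[n,j]h[j]≈-8·4^kW[k] j (suc k) (trans (ℕ.+-suc j k) 1+j+k≡n)))
                    (*-congˡ (+ 4) (C[n,k]≈-2·4^kC[n+k,2k+1] k k<n)) ⟩
        - (c * d) * (- + 8 * (+ 4 * X * W (suc k))) + + 4 * (- + 2 * (X * B))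
          ≡⟨ alg₄ (c * d) X (W (suc k)) B ⟩
        + 8 * X * (+ 4 * (c * d) * W (suc k)) + - + 8 * (X * B)
          ≈⟨ +-congʳ (- + 8 * (X * B)) (*-congˡ (+ 8 * X) (W-step k)) ⟩
        + 8 * X * (B + - (c * c) * W k) + - + 8 * (X * B)
          ≡⟨ alg₅ c X B (W k) ⟩
        c * (c * (- + 8 * (X * W k))) ∎))
      where
      J = + j
      K = + k
      X = (+ 4) ^ k
      c = 1ℤ + (K + K)
      d = + 2 + (K + K)
      t = - + 2 * (1ℤ + J)
      a = n Cℤ j
      a′ = n Cℤ suc j
      v = ν (+ suc j)
      B = (n ℕ.+ k) Cℤ suc (k ℕ.+ k)
      N≡ : N ≡ 1ℤ + J + K
      N≡ = cong +_ (sym 1+j+k≡n)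
      a′≡ : a′ ≡ n Cℤ k
      a′≡ = subst (λ n → n Cℤ suc j ≡ n Cℤ k) 1+j+k≡n (Cℤ-sym (suc j) k)
      k<n : k < n
      k<n = subst (k <_) 1+j+k≡n (s≤s (ℕ.m≤n+m k j))
      j+1<p : suc j < p
      j+1<p = s≤s (ℕ.≤-trans (subst (suc j ≤_) 1+j+k≡n (ℕ.m≤m+n (suc j) k)) (ℕ.m≤m+n n n))
      c≈ : c ≈ t
      -- Because 2 (j + 1) + (2k + 1) = p.
      c≈ = 1ℤ by trans (alg J K) (cong (λ z → t + 1ℤ * (1ℤ + (z + z))) (sym N≡))
        where
        alg : ∀ J K → 1ℤ + (K + K) ≡ - + 2 * (1ℤ + J) + 1ℤ * (1ℤ + (1ℤ + J + K + (1ℤ + J + K)))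
        alg = solve-∀
      alg₁ : ∀ c a h v → c * (c * (a * (h + v))) ≡ c * (c * (a * h)) + c * (c * (a * v))
      alg₁ = solve-∀
      alg₂ : ∀ c u a h v → c * (- + 2 * u * (a * h)) + - + 2 * u * (- + 2 * u * (a * v))
        ≡ - + 2 * c * (u * a) * h + + 4 * a * (u * u * v)
      alg₂ = solve-∀
      alg₃ : ∀ J K a h b → - + 2 * (1ℤ + (K + K)) * ((1ℤ + J + K + - J) * a) * h + + 4 * b * 1ℤ
        ≡ - ((1ℤ + (K + K)) * (+ 2 + (K + K))) * (a * h) + + 4 * b
      alg₃ = solve-∀
      alg₄ : ∀ e X w B → - e * (- + 8 * (+ 4 * X * w)) + + 4 * (- + 2 * (X * B))
        ≡ + 8 * X * (+ 4 * e * w) + - + 8 * (X * B)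
      alg₄ = solve-∀
      alg₅ : ∀ c X B w → + 8 * X * (B + - (c * c) * w) + - + 8 * (X * B) ≡ c * (c * (- + 8 * (X * w)))
      alg₅ = solve-∀

    -- The sign of (-2)^n modulo p.

    [-2]^k[-2]^k≡4^k : ∀ k → (- + 2) ^ k * (- + 2) ^ k ≡ (+ 4) ^ k
    [-2]^k[-2]^k≡4^k k = sym (*-^ (- + 2) (- + 2) k)

    [-2]^n≡ : ∀ j k → j ℕ.+ k ≡ n → (- + 2) ^ n ≡ (- + 2) ^ j * (- + 2) ^ k
    [-2]^n≡ j k eq = trans (cong ((- + 2) ^_) (sym eq)) (ℤ.^-distribˡ-+-* (- + 2) j k)

    -- In effect `χ n` is the Legendre symbol of 2, by Euler's criterion. Multiplication by (-2)^n =
    -- (-2)^j (-2)^k produces 4^k, which turns C(n+k,2k) into C(n,k) = C(n,j); the binomial theorem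
    -- at -2 then sums the series to (1 - 2)^n.
    [-2]^nχ[n]≈[-1]^n : (- + 2) ^ n * χ n ≈ -1ℤ ^ n
    [-2]^nχ[n]≈[-1]^n = begin
      (- + 2) ^ n * χ n
        ≡⟨ cong ((- + 2) ^ n *_) (proj₁ (χ-as-sum n n ℕ.≤-refl)) ⟨
      (- + 2) ^ n * Σ< (suc n) (λ k → (n ℕ.+ k) Cℤ (k ℕ.+ k) * (- + 2) ^ k)
        ≡⟨ *-distribˡ-Σ< (suc n) ((- + 2) ^ n) _ ⟨
      Σ< (suc n) (λ k → (- + 2) ^ n * ((n ℕ.+ k) Cℤ (k ℕ.+ k) * (- + 2) ^ k))
        ≈⟨ Σ<-reverse (suc n) (λ k j eq → termwise k j (ℕ.suc-injective eq)) ⟩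
      Σ< (suc n) (λ j → n Cℤ j * (- + 2) ^ j)
        ≡⟨ binomial-theorem n (- + 2) ⟨
      -1ℤ ^ n ∎
      where
      alg : ∀ x y c → x * y * (c * x) ≡ y * (x * x * c)
      alg = solve-∀
      termwise : ∀ k j → k ℕ.+ j ≡ n →
        (- + 2) ^ n * ((n ℕ.+ k) Cℤ (k ℕ.+ k) * (- + 2) ^ k) ≈ n Cℤ j * (- + 2) ^ j
      termwise k j eq = begin
        (- + 2) ^ n * (c * x)      ≡⟨ cong (_* (c * x)) ([-2]^n≡ k j eq) ⟩
        x * y * (c * x)            ≡⟨ alg x y c ⟩
        y * (x * x * c)            ≡⟨ cong (λ z → y * (z * c)) ([-2]^k[-2]^k≡4^k k) ⟩
        y * ((+ 4) ^ k * c)        ≈⟨ *-congˡ y (4^kC[n+k,2k]≈C[n,k] k (subst (k ≤_) eq (ℕ.m≤m+n k j))) ⟩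
        y * n Cℤ k                 ≡⟨ ℤ.*-comm y (n Cℤ k) ⟩
        n Cℤ k * y                 ≡⟨ cong (_* y) (subst (λ n → n Cℤ k ≡ n Cℤ j) eq (Cℤ-sym k j)) ⟩
        n Cℤ j * y                 ∎
        where
        c = (n ℕ.+ k) Cℤ (k ℕ.+ k)
        x = (- + 2) ^ k
        y = (- + 2) ^ j

    [-2]^n≈[-1]^nχ[n] : (- + 2) ^ n ≈ -1ℤ ^ n * χ n
    [-2]^n≈[-1]^nχ[n] = begin
      (- + 2) ^ n                    ≡⟨ ℤ.*-identityʳ _ ⟨
      (- + 2) ^ n * 1ℤ               ≡⟨ cong ((- + 2) ^ n *_) (χ² n) ⟨
      (- + 2) ^ n * (χ n * χ n)      ≡⟨ ℤ.*-assoc ((- + 2) ^ n) (χ n) (χ n) ⟨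
      (- + 2) ^ n * χ n * χ n        ≈⟨ *-congʳ (χ n) [-2]^nχ[n]≈[-1]^n ⟩
      -1ℤ ^ n * χ n                  ∎

    -- From the central binomial sum to a signed sum of inverse squares.

    -- Twice this integer is p + 1.
    half : ℤ
    half = + suc n

    2half≈1 : + 2 * half ≈ 1ℤ
    2half≈1 = 1ℤ by alg N
      where
      alg : ∀ N → + 2 * (1ℤ + N) ≡ 1ℤ + 1ℤ * (1ℤ + (N + N))
      alg = solve-∀

    S T : ℤ
    S = Σ< p (λ k → (k ℕ.+ k) Cℤ k * half ^ k * h k)
    T = Σ< (suc n) (λ k → n Cℤ k * (- + 2) ^ k * h k)

    S≈T : S ≈ T
    S≈T = begin
      S
        ≈⟨ Σ<-cong-≈ p (λ k k<p → *-congʳ (h k) (termwise k k<p)) ⟩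
      -- The range of length p is cut after k = n, beyond which C(n,k) is zero.
      Σ< (suc n ℕ.+ n) term
        ≡⟨ Σ<-+ (suc n) n term ⟩
      T + Σ< n (term ∘ (suc n ℕ.+_))
        ≡⟨ cong (_+_ T) (Σ<-zero n (term ∘ (suc n ℕ.+_)) λ k → cong (λ z → z * (- + 2) ^ (suc n ℕ.+ k) * h (suc n ℕ.+ k))
                         (Cℤ-zero {n} {suc n ℕ.+ k} (s≤s (ℕ.m≤m+n n k)))) ⟩
      T + 0ℤ
        ≡⟨ ℤ.+-identityʳ T ⟩
      T ∎
      where
      term : ℕ → ℤ
      term k = n Cℤ k * (- + 2) ^ k * h k
      -4half≈-2 : - + 4 * half ≈ - + 2
      -4half≈-2 = (- + 2) by alg N
        where
        alg : ∀ N → - + 4 * (1ℤ + N) ≡ - + 2 + - + 2 * (1ℤ + (N + N))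
        alg = solve-∀
      alg : ∀ x y z → x * y * z ≡ y * (x * z)
      alg = solve-∀
      termwise : ∀ k → k < p → (k ℕ.+ k) Cℤ k * half ^ k ≈ n Cℤ k * (- + 2) ^ k
      termwise k k<p = begin
        (k ℕ.+ k) Cℤ k * half ^ k              ≈⟨ *-congʳ (half ^ k) (C[2k,k]≈[-4]^kC[n,k] k k<p) ⟩
        (- + 4) ^ k * n Cℤ k * half ^ k        ≡⟨ alg ((- + 4) ^ k) (n Cℤ k) (half ^ k) ⟩
        n Cℤ k * ((- + 4) ^ k * half ^ k)      ≡⟨ cong (n Cℤ k *_) (*-^ (- + 4) half k) ⟨
        n Cℤ k * (- + 4 * half) ^ k            ≈⟨ *-congˡ (n Cℤ k) (^-cong k -4half≈-2) ⟩
        n Cℤ k * (- + 2) ^ k                   ∎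

    odd-ν : ℕ → ℤ
    odd-ν m = ν (+ suc (m ℕ.+ m))

    T≈-8[-2]^nΣχν : T ≈ - + 8 * (- + 2) ^ n * Σ< n (λ m → χ m * odd-ν m)
    T≈-8[-2]^nΣχν = begin
      T
        -- As j + k = n, the factor (-2)^j 4^k equals (-2)^n (-2)^k: the first power leaves the sum,
        -- the second is the weight in `χ-as-sum`.
        ≈⟨ Σ<-reverse (suc n) (λ j k eq → termwise j k (ℕ.suc-injective eq)) ⟩
      Σ< (suc n) (λ k → e * ((- + 2) ^ k * W k))
        ≡⟨ *-distribˡ-Σ< (suc n) e _ ⟩
      e * Σ< (suc n) (λ k → (- + 2) ^ k * W k)
        ≡⟨ cong (e *_) (Σ<-cong (suc n) λ k → sym (*-distribˡ-Σ< n ((- + 2) ^ k) _)) ⟩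
      e * Σ< (suc n) (λ k → Σ< n (λ m → (- + 2) ^ k * ((m ℕ.+ k) Cℤ (k ℕ.+ k) * odd-ν m)))
        ≡⟨ cong (e *_) (Σ<-comm (suc n) n _) ⟩
      e * Σ< n (λ m → Σ< (suc n) (λ k → (- + 2) ^ k * ((m ℕ.+ k) Cℤ (k ℕ.+ k) * odd-ν m)))
        ≈⟨ *-congˡ e (Σ<-cong-≈ n collect) ⟩
      e * Σ< n (λ m → χ m * odd-ν m) ∎
      where
      e = - + 8 * (- + 2) ^ n
      alg₁ : ∀ c x y → c * x * y ≡ x * (c * y)
      alg₁ = solve-∀
      alg₂ : ∀ x y w → x * (- + 8 * (y * y * w)) ≡ - + 8 * (x * y) * (y * w)
      alg₂ = solve-∀
      termwise : ∀ j k → j ℕ.+ k ≡ n → n Cℤ j * (- + 2) ^ j * h j ≈ e * ((- + 2) ^ k * W k)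
      termwise j k eq = begin
        n Cℤ j * x * h j                     ≡⟨ alg₁ (n Cℤ j) x (h j) ⟩
        x * (n Cℤ j * h j)                   ≈⟨ *-congˡ x (C[n,j]h[j]≈-8·4^kW[k] j k eq) ⟩
        x * (- + 8 * ((+ 4) ^ k * W k))      ≡⟨ cong (λ z → x * (- + 8 * (z * W k))) ([-2]^k[-2]^k≡4^k k) ⟨
        x * (- + 8 * (y * y * W k))          ≡⟨ alg₂ x y (W k) ⟩
        - + 8 * (x * y) * (y * W k)          ≡⟨ cong (λ z → - + 8 * z * (y * W k)) ([-2]^n≡ j k eq) ⟨
        e * (y * W k)                        ∎
        where
        x = (- + 2) ^ j
        y = (- + 2) ^ k
      alg₃ : ∀ x c v → x * (c * v) ≡ v * (c * x)
      alg₃ = solve-∀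
      collect : ∀ m → m < n →
        Σ< (suc n) (λ k → (- + 2) ^ k * ((m ℕ.+ k) Cℤ (k ℕ.+ k) * odd-ν m)) ≈ χ m * odd-ν m
      collect m m<n = begin
        Σ< (suc n) (λ k → (- + 2) ^ k * ((m ℕ.+ k) Cℤ (k ℕ.+ k) * odd-ν m))
          ≡⟨ Σ<-cong (suc n) (λ k → alg₃ ((- + 2) ^ k) ((m ℕ.+ k) Cℤ (k ℕ.+ k)) (odd-ν m)) ⟩
        Σ< (suc n) (λ k → odd-ν m * ((m ℕ.+ k) Cℤ (k ℕ.+ k) * (- + 2) ^ k))
          ≡⟨ *-distribˡ-Σ< (suc n) (odd-ν m) _ ⟩
        odd-ν m * Σ< (suc n) (λ k → (m ℕ.+ k) Cℤ (k ℕ.+ k) * (- + 2) ^ k)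
          ≡⟨ cong (odd-ν m *_) (proj₁ (χ-as-sum n m (ℕ.<⇒≤ m<n))) ⟩
        odd-ν m * χ m
          ≡⟨ ℤ.*-comm (odd-ν m) (χ m) ⟩
        χ m * odd-ν m ∎

    -- Here 2m + 1 = p - 2 (i + 1), the exponent in `ν` is even, and 4 `ν` 2 ≡ 1.
    4odd-ν≈ν : ∀ m i → m ℕ.+ suc i ≡ n → + 4 * odd-ν m ≈ ν (+ suc i)
    4odd-ν≈ν m i eq = begin
      + 4 * ν (+ suc (m ℕ.+ m))           ≈⟨ *-congˡ (+ 4) (^-cong (q ℕ.+ q) reflect) ⟩
      + 4 * ν (- (+ 2 * + suc i))         ≡⟨ cong (+ 4 *_) (neg-^-even (+ 2 * + suc i) q) ⟩
      + 4 * ν (+ 2 * + suc i)             ≡⟨ cong (+ 4 *_) (*-^ (+ 2) (+ suc i) (q ℕ.+ q)) ⟩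
      + 4 * (ν (+ 2) * ν (+ suc i))       ≡⟨ ℤ.*-assoc (+ 4) (ν (+ 2)) _ ⟨
      + 4 * ν (+ 2) * ν (+ suc i)         ≈⟨ *-congʳ (ν (+ suc i)) (ν-inverse {2} z<s (even<p {0} z<s)) ⟩
      1ℤ * ν (+ suc i)                    ≡⟨ ℤ.*-identityˡ _ ⟩
      ν (+ suc i)                         ∎
      where
      alg : ∀ M I → 1ℤ + (M + M) ≡ - (+ 2 * (1ℤ + I)) + 1ℤ * (1ℤ + (M + (1ℤ + I) + (M + (1ℤ + I))))
      alg = solve-∀
      reflect : + suc (m ℕ.+ m) ≈ - (+ 2 * + suc i)
      reflect = 1ℤ by trans (alg (+ m) (+ i))
        (cong (λ n → - (+ 2 * + suc i) + 1ℤ * (1ℤ + (+ n + + n))) eq)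

    -- Folding by the reflection r ↦ p - r.

    τ : ℕ → ℤ
    τ r = ω (-1ℤ ^ n) r * ν (+ r)

    τ-reflect : ∀ a b → a ℕ.+ b ≡ p → τ a ≈ τ b
    τ-reflect a b eq = *-cong (≡⇒≈ (ω-reflect n a b eq)) (begin
      ν (+ a)      ≈⟨ ^-cong (q ℕ.+ q) (1ℤ by trans (alg (+ a) (+ b)) (cong (λ p → - + b + 1ℤ * + p) eq)) ⟩
      ν (- + b)    ≡⟨ neg-^-even (+ b) q ⟩
      ν (+ b)      ∎)
      where
      alg : ∀ A B → A ≡ - B + 1ℤ * (A + B)
      alg = solve-∀

    T≈-2Στ : T ≈ - + 2 * Σ< n (τ ∘ suc)
    T≈-2Στ = begin
      T
        ≈⟨ T≈-8[-2]^nΣχν ⟩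
      - + 8 * (- + 2) ^ n * Σ< n (λ m → χ m * odd-ν m)
        ≈⟨ *-congʳ (Σ< n (λ m → χ m * odd-ν m)) (*-congˡ (- + 8) [-2]^n≈[-1]^nχ[n]) ⟩
      - + 8 * (-1ℤ ^ n * χ n) * Σ< n (λ m → χ m * odd-ν m)
        ≡⟨ *-distribˡ-Σ< n (- + 8 * (-1ℤ ^ n * χ n)) _ ⟨
      Σ< n (λ m → - + 8 * (-1ℤ ^ n * χ n) * (χ m * odd-ν m))
        ≈⟨ Σ<-reverse n (λ m i eq → termwise m i (trans (ℕ.+-suc m i) eq)) ⟩
      Σ< n (λ i → - + 2 * τ (suc i))
        ≡⟨ *-distribˡ-Σ< n (- + 2) _ ⟩
      - + 2 * Σ< n (τ ∘ suc) ∎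
      where
      alg : ∀ c x v → - + 8 * c * (x * v) ≡ - + 2 * (c * x * (+ 4 * v))
      alg = solve-∀
      termwise : ∀ m i → m ℕ.+ suc i ≡ n → - + 8 * (-1ℤ ^ n * χ n) * (χ m * odd-ν m) ≈ - + 2 * τ (suc i)
      termwise m i eq = begin
        - + 8 * (-1ℤ ^ n * χ n) * (χ m * odd-ν m)
          ≡⟨ alg (-1ℤ ^ n * χ n) (χ m) (odd-ν m) ⟩
        - + 2 * (-1ℤ ^ n * χ n * χ m * (+ 4 * odd-ν m))
          ≈⟨ *-congˡ (- + 2) (*-cong (≡⇒≈ (ω-χ n m (suc i) eq)) (4odd-ν≈ν m i eq)) ⟩
        - + 2 * τ (suc i) ∎

    -- The reflection r ↦ p - r preserves τ, folds {1, …, p - 1} onto {1, …, n}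
    -- and exchanges its odd and even members.
    Στ≈Στ-odd : Σ< n (τ ∘ suc) ≈ Σ< n (λ m → τ (suc (m ℕ.+ m)))
    Στ≈Στ-odd = *-cancelˡ p-prime {2} z<s (even<p {0} z<s) (begin
      + 2 * A
        ≡⟨ alg A ⟩
      A + A
        ≈⟨ +-congˡ A (Σ<-reverse n λ i j eq → τ-reflect (suc i) (suc (n ℕ.+ j)) (upper i j eq)) ⟩
      A + Σ< n (λ i → τ (suc (n ℕ.+ i)))
        ≡⟨ Σ<-+ n n (τ ∘ suc) ⟨
      Σ< (n ℕ.+ n) (τ ∘ suc)
        ≡⟨ Σ<-pairs n (τ ∘ suc) ⟩
      B + Σ< n (λ m → τ (suc (suc (m ℕ.+ m))))
        ≈⟨ +-congˡ B (Σ<-reverse n λ i j eq → τ-reflect (suc (suc (i ℕ.+ i))) (suc (j ℕ.+ j)) (parity i j eq)) ⟩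
      B + B
        ≡⟨ alg B ⟨
      + 2 * B ∎)
      where
      A = Σ< n (τ ∘ suc)
      B = Σ< n (λ m → τ (suc (m ℕ.+ m)))
      alg : ∀ x → + 2 * x ≡ x + x
      alg = solve-∀
      upper : ∀ i j → suc (i ℕ.+ j) ≡ n → suc i ℕ.+ suc (n ℕ.+ j) ≡ p
      upper i j eq = trans (nat n i j) (cong (λ k → suc (n ℕ.+ k)) eq)
        where
        nat : ∀ n i j → suc i ℕ.+ suc (n ℕ.+ j) ≡ suc (n ℕ.+ suc (i ℕ.+ j))
        nat = ℕ-Solver.solve-∀
      parity : ∀ i j → suc (i ℕ.+ j) ≡ n → suc (suc (i ℕ.+ i)) ℕ.+ suc (j ℕ.+ j) ≡ p
      parity i j eq = trans (nat i j) (cong (λ k → suc (k ℕ.+ k)) eq)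
        where
        nat : ∀ i j → suc (suc (i ℕ.+ i)) ℕ.+ suc (j ℕ.+ j) ≡ suc (suc (i ℕ.+ j) ℕ.+ suc (i ℕ.+ j))
        nat = ℕ-Solver.solve-∀

    -- Alternating sums of odd powers and the Euler numbers.

    Q : ℕ → ℤ
    Q i = + 2 * Σ< n (λ m → -1ℤ ^ m * (+ suc (m ℕ.+ m)) ^ i)

    S≈-Q : S ≈ - Q (q ℕ.+ q)
    S≈-Q = begin
      S                                               ≈⟨ S≈T ⟩
      T                                               ≈⟨ T≈-2Στ ⟩
      - + 2 * Σ< n (τ ∘ suc)                          ≈⟨ *-congˡ (- + 2) Στ≈Στ-odd ⟩
      - + 2 * Σ< n (λ m → τ (suc (m ℕ.+ m)))          ≡⟨ cong (- + 2 *_) (Σ<-cong n λ m → cong (_* odd-ν m) (ω-odd (-1ℤ ^ n) m)) ⟩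
      - + 2 * Σ< n (λ m → -1ℤ ^ m * odd-ν m)          ≡⟨ alg _ ⟩
      - Q (q ℕ.+ q)                                   ∎
      where
      alg : ∀ x → - + 2 * x ≡ - (+ 2 * x)
      alg = solve-∀

    -- The factor 2 in `Q` is the one that `even-binomial-sum` requires. At the upper end 2n ≡ -1,
    -- so the boundary value (2n)^(2M) is 1; at the lower end 0^(2M) is the value that `evenSum-E`
    -- has.
    evenSum-Q : ∀ M → evenSum M Q ≈ 0ℤ ^ (M ℕ.+ M) + - -1ℤ ^ n
    evenSum-Q M = begin
      evenSum M Q
        ≡⟨ Σ<-cong (suc N₂) (λ i → cong (λ z → ε i * (N₂ Cℤ i * z)) (sym (*-distribˡ-Σ< n (+ 2) _))) ⟩
      evenSum M (λ i → Σ< n (λ m → + 2 * (-1ℤ ^ m * odd m ^ i)))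
        ≡⟨ Σ<-cong (suc N₂) (λ i → cong (λ z → ε i * (N₂ Cℤ i * z)) (Σ<-cong n λ m → sym (ℤ.*-assoc (+ 2) (-1ℤ ^ m) _))) ⟩
      evenSum M (λ i → Σ< n (λ m → + 2 * -1ℤ ^ m * odd m ^ i))
        ≡⟨ evenSum-Σ< M n (λ m → + 2 * -1ℤ ^ m) (λ m i → odd m ^ i) ⟩
      Σ< n (λ m → + 2 * -1ℤ ^ m * evenSum M (odd m ^_))
        ≡⟨ Σ<-cong n termwise ⟩
      Σ< n (λ m → -1ℤ ^ m * (f (suc m) + f m))
        ≡⟨ telescope n f ⟩
      f 0 + - (-1ℤ ^ n * f n)
        ≈⟨ +-congˡ (f 0) (-‿cong (*-congˡ (-1ℤ ^ n) (^-cong N₂ 2n≈-1))) ⟩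
      f 0 + - (-1ℤ ^ n * -1ℤ ^ N₂)
        ≡⟨ cong (λ z → f 0 + - (-1ℤ ^ n * z)) (trans (ℤ.^-distribˡ-+-* -1ℤ M M) (-1^-square M)) ⟩
      f 0 + - (-1ℤ ^ n * 1ℤ)
        ≡⟨ cong (λ z → f 0 + - z) (ℤ.*-identityʳ (-1ℤ ^ n)) ⟩
      0ℤ ^ N₂ + - -1ℤ ^ n ∎
      where
      N₂ : ℕ
      N₂ = M ℕ.+ M
      odd f : ℕ → ℤ
      odd m = + suc (m ℕ.+ m)
      f m = (+ (m ℕ.+ m)) ^ N₂
      2n≈-1 : + (n ℕ.+ n) ≈ -1ℤ
      2n≈-1 = 1ℤ by alg N
        where
        alg : ∀ N → N + N ≡ -1ℤ + 1ℤ * (1ℤ + (N + N))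
        alg = solve-∀
      alg₁ : ∀ s x → + 2 * s * x ≡ s * (+ 2 * x)
      alg₁ = solve-∀
      alg₂ : ∀ x → 1ℤ + - (1ℤ + x) ≡ - x
      alg₂ = solve-∀
      termwise : ∀ m → + 2 * -1ℤ ^ m * evenSum M (odd m ^_) ≡ -1ℤ ^ m * (f (suc m) + f m)
      termwise m = trans (alg₁ (-1ℤ ^ m) _) (cong (-1ℤ ^ m *_) (trans (even-binomial-sum N₂ (odd m))
        (cong₂ _+_ (cong (λ k → (+ suc k) ^ N₂) (sym (ℕ.+-suc m m)))
                   (trans (cong (_^ N₂) (alg₂ (+ (m ℕ.+ m)))) (neg-^-even (+ (m ℕ.+ m)) M)))))

    -- 0ℤ ^ i (with 0 ^ 0 = 1) absorbs the boundary term of the telescoping sum.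
    defect : ℕ → ℤ
    defect i = E i + - (Q i + -1ℤ ^ n * 0ℤ ^ i)

    evenSum-defect : ∀ M → evenSum M defect ≈ 0ℤ
    evenSum-defect M = begin
      evenSum M defect
        ≡⟨ evenSum-linear M E Q (λ i → -1ℤ ^ n * 0ℤ ^ i) ⟩
      evenSum M E + - (evenSum M Q + evenSum M (λ i → -1ℤ ^ n * 0ℤ ^ i))
        ≡⟨ cong₂ (λ a b → a + - (evenSum M Q + b)) (evenSum-E M) scaled ⟩
      z + - (evenSum M Q + s)
        ≈⟨ +-congˡ z (-‿cong (+-congʳ s (evenSum-Q M))) ⟩
      z + - (z + - s + s)
        ≡⟨ alg z s ⟩
      0ℤ ∎
      where
      s = -1ℤ ^ n
      z = 0ℤ ^ (M ℕ.+ M)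
      alg : ∀ z s → z + - (z + - s + s) ≡ 0ℤ
      alg = solve-∀
      swap : ∀ e c s x → e * (c * (s * x)) ≡ s * (e * (c * x))
      swap = solve-∀
      scaled : evenSum M (λ i → s * 0ℤ ^ i) ≡ s
      scaled = trans (Σ<-cong (suc (M ℕ.+ M)) λ i → swap (ε i) ((M ℕ.+ M) Cℤ i) s (0ℤ ^ i))
        (trans (*-distribˡ-Σ< (suc (M ℕ.+ M)) s _) (trans (cong (s *_) (evenSum-0^ M)) (ℤ.*-identityʳ s)))

    -- In `evenSum M defect`, which is zero modulo p, induction removes every term but the top one.
    defect≈0 : ∀ M → defect (M ℕ.+ M) ≈ 0ℤ
    defect≈0 = <-rec (λ M → defect (M ℕ.+ M) ≈ 0ℤ) λ M rec → begin
      defect (M ℕ.+ M)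
        ≡⟨ ℤ.+-identityˡ _ ⟨
      0ℤ + defect (M ℕ.+ M)
        ≈⟨ +-congʳ (defect (M ℕ.+ M)) (Σ<-≈0 M λ k k<M → ≈-trans (*-congˡ ((M ℕ.+ M) Cℤ (k ℕ.+ k)) (rec k<M))
             (≡⇒≈ (ℤ.*-zeroʳ ((M ℕ.+ M) Cℤ (k ℕ.+ k))))) ⟨
      Σ< M (λ k → (M ℕ.+ M) Cℤ (k ℕ.+ k) * defect (k ℕ.+ k)) + defect (M ℕ.+ M)
        ≡⟨ evenSum-split M defect ⟨
      evenSum M defect
        ≈⟨ evenSum-defect M ⟩
      0ℤ ∎

    E≈Q : 0 < q → E (q ℕ.+ q) ≈ Q (q ℕ.+ q)
    -- Matching `z<s` makes the exponent a successor, so the power of zero in `defect` computes to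
    -- zero.
    E≈Q z<s = begin
      E (q ℕ.+ q)                                    ≡⟨ alg (E (q ℕ.+ q)) (Q (q ℕ.+ q)) (-1ℤ ^ n) ⟩
      defect (q ℕ.+ q) + Q (q ℕ.+ q)                 ≈⟨ +-congʳ (Q (q ℕ.+ q)) (defect≈0 q) ⟩
      0ℤ + Q (q ℕ.+ q)                               ≡⟨ ℤ.+-identityˡ _ ⟩
      Q (q ℕ.+ q)                                    ∎
      where
      alg : ∀ e q s → e ≡ e + - (q + s * 0ℤ) + q
      alg = solve-∀

    S≈-E : 0 < q → S ≈ - E (q ℕ.+ q)
    S≈-E 0<q = ≈-trans S≈-Q (-‿cong (≈-sym (E≈Q 0<q)))

    -- The summands as p-integral rationals.

    -- The bound k < p keeps p out of all the denominators, and `ν-inverse` supplies their inverses.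
    ↦-h : ∀ k → k < p → H⁽²⁾ k ↦ h k
    ↦-h k k<p = ↦-Σ< k _ _ (λ i →
      ↦-/ 1ℤ (suc (toℕ i) ℕ.^ 2) (∤-^ 2 (∤-< z<s (bound i))) (inverse i))
      where
      bound : ∀ (i : Fin k) → suc (toℕ i) < p
      bound i = ℕ.≤-<-trans (toℕ<n i) k<p
      alg : ∀ a v → a * a * v ≡ v * (a * (a * 1ℤ))
      alg = solve-∀
      inverse : ∀ i → 1ℤ ≈ ν (+ suc (toℕ i)) * + (suc (toℕ i) ℕ.^ 2)
      inverse i = begin
        1ℤ                      ≈⟨ ν-inverse z<s (bound i) ⟨
        a * a * ν a             ≡⟨ alg a (ν a) ⟩
        ν a * a ^ 2             ≡⟨ cong (ν a *_) (pos-^ (suc (toℕ i)) 2) ⟨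
        ν a * + (suc (toℕ i) ℕ.^ 2) ∎
        where
        a : ℤ
        a = + suc (toℕ i)

    ↦-C/2^k : ∀ k → _/_ (+ ((2 ℕ.* k) C k)) (2 ℕ.^ k) {{ℕ.m^n≢0 2 k}} ↦ (k ℕ.+ k) Cℤ k * half ^ k
    ↦-C/2^k k = ↦-/ _ (2 ℕ.^ k) {{ℕ.m^n≢0 2 k}} (∤-^ k (∤-< z<s (even<p {0} z<s))) (begin
      + ((2 ℕ.* k) C k)                           ≡⟨ cong (λ m → + (m C k)) (cong (k ℕ.+_) (ℕ.+-identityʳ k)) ⟩
      + ((k ℕ.+ k) C k)                           ≡⟨ Cℤ-C (k ℕ.+ k) k ⟨
      c                                           ≡⟨ ℤ.*-identityʳ c ⟨
      c * 1ℤ                                      ≡⟨ cong (c *_) (ℤ.^-zeroˡ k) ⟨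
      c * 1ℤ ^ k                                  ≈⟨ *-congˡ c (^-cong k 2half≈1) ⟨
      c * (+ 2 * half) ^ k                        ≡⟨ cong (c *_) (*-^ (+ 2) half k) ⟩
      c * ((+ 2) ^ k * half ^ k)                  ≡⟨ alg c ((+ 2) ^ k) (half ^ k) ⟩
      c * half ^ k * (+ 2) ^ k                    ≡⟨ cong (c * half ^ k *_) (pos-^ 2 k) ⟨
      c * half ^ k * + (2 ℕ.^ k)                  ∎)
      where
      c : ℤ
      c = (k ℕ.+ k) Cℤ k
      alg : ∀ c x y → c * (x * y) ≡ c * y * x
      alg = solve-∀

    summand : ℕ → ℚ
    summand k = _/_ (+ ((2 ℕ.* k) C k)) (2 ℕ.^ k) {{ℕ.m^n≢0 2 k}} ℚ.* H⁽²⁾ k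

    congruence : 0 < q → ∑ℚ.sum {p} (summand ∘ toℕ) ≡ ℚ.- (E (p ℕ.∸ 3) / 1) [mod p ]
    congruence 0<q = ↦⇒≡mod
      (↦-Σ< p (summand ∘ toℕ) _ λ i → ↦-* (↦-C/2^k (toℕ i)) (↦-h (toℕ i) (toℕ<n i)))
      (↦-neg (↦-int (E (p ℕ.∸ 3))))
      (≈-trans (S≈-E 0<q) (≡⇒≈ (cong (λ k → - E k) (sym (cong (ℕ._∸ 1) (ℕ.+-suc q q))))))

  even-or-odd : ∀ m → ∃[ k ] (m ≡ k ℕ.+ k ⊎ m ≡ suc (k ℕ.+ k))
  even-or-odd zero = 0 , inj₁ refl
  even-or-odd (suc m) with even-or-odd m
  ... | k , inj₁ refl = k , inj₂ refl
  ... | k , inj₂ refl = suc k , inj₁ (cong suc (sym (ℕ.+-suc k k)))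

  prime>3⇒odd : ∀ {p} → Prime p → 3 < p → ∃[ q ] (0 < q × p ≡ suc (suc q ℕ.+ suc q))
  prime>3⇒odd {p} p-prime 3<p with even-or-odd p
  ... | k , inj₁ refl = case prime⇒irreducible p-prime 2∣p of λ where
      (inj₂ 2≡p) → contradiction (subst (3 <_) (sym 2≡p) 3<p) λ { (s≤s (s≤s ())) }
    where
    2∣p : 2 ℕ.∣ k ℕ.+ k
    2∣p = ℕ.divides k (trans (cong (k ℕ.+_) (sym (ℕ.+-identityʳ k))) (ℕ.*-comm 2 k))
  -- Here k is n = q + 1. Discarding p = 1 and p = 3 leaves a positive q.
  ... | 0           , inj₂ refl = contradiction 3<p λ { (s≤s ()) }
  ... | 1           , inj₂ refl = contradiction 3<p λ { (s≤s (s≤s (s≤s ()))) }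
  ... | suc (suc q) , inj₂ refl = suc q , z<s , refl

open import Data.Fin.Base using (toℕ)
open import Data.Integer.Base using (+_)
open import Data.Nat.Base using (ℕ; _<_; _∸_; _^_) renaming (_*_ to _*ℕ_)
open import Data.Nat.Combinatorics using (_C_)
open import Data.Nat.Primality using (Prime)
open import Data.Nat.Properties using (m^n≢0)
open import Data.Product.Base using (_,_)
open import Data.Rational.Base using (_/_; _*_; -_)
open import Relation.Binary.PropositionalEquality using (refl)
open ∑ℚ using (sum-syntax)

theorem1p2 : (p : ℕ) → Prime p → 3 < p →
    (∑[ i < p ] (let k = toℕ i in
    _/_ (+ ((2 *ℕ k) C k)) (2 ^ k) {{m^n≢0 2 k}} * H⁽²⁾ k))
    ≡ - (E (p ∸ 3) / 1) [mod p ]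
theorem1p2 p p-prime 3<p with Proof.prime>3⇒odd p-prime 3<p
... | q , 0<q , refl = Proof.OddPrime.congruence q p-prime 0<q
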